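{- Let $a$ be a nonzero even integer, let $k,m$ be positive integers with $m\ge 4$, and let $b$ be a nonnegative integer. If $b$ is even, then $$E_{2^mk+b}^{(a)}-E_b^{(a)}\equiv 2^{m}k\{9a^3b^2-(2a^3-128a)b+86a^3-257a+2^{m}ka^3(b-1)\}\pmod{2^{m+10}}.$$ If $b$ is odd, then $$E_{2^mk+b}^{(a)}-E_b^{(a)}\equiv 2^{m}k\{(a^3-2a^5)b^2+(30a^3+128a)b-2a^5+86a^3+127a+2^{m}ka^3(b-1)\}\pmod{2^{m+10}}.$$
   Context: For a nonzero integer $a$, the sequence $\{E_n^{(a)}\}_{n\ge 0}$ is the sequence of integers defined recursively by $$\sum_{j=0}^{\lfloor n/2\rfloor}\binom{n}{2j}a^{2j}E_{n-2j}^{(a)}=(1-a)^n\quad(n=0,1,2,\ldots).$$ -}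

module Defs where

open import Data.Fin using (Fin; toℕ)
open import Data.Integer
open import Data.Integer.Divisibility.Signed using (_∣_)
open import Data.Integer.Properties using (+-0-monoid; *-identityˡ)
open import Data.Integer.Solver using (module +-*-Solver)
open import Data.Nat as ℕ using (ℕ; ⌊_/2⌋)
open import Data.Nat.Combinatorics using (_C_; nCk≡nC[n∸k]; nCn≡1)
open import Data.Nat.Induction using (<-rec; <-wellFounded; <-Rec)
import Data.Nat.Properties as ℕ
open import Function using (_$_)
open import Induction.WellFounded using (module FixPoint)
open import Relation.Binary.PropositionalEquality
open import Algebra.Properties.Monoid.Sum +-0-monoid using (sum-cong-≗; sum-syntax; sum⁺-syntax)

_≡_[mod_] : ℤ → ℤ → ℤ → Set
x ≡ y [mod n ] = n ∣ x - y

infix 4 _≡_[mod_]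

private
  descends : ∀ n (i : Fin ⌊ n /2⌋) → n ℕ.∸ 2 ℕ.* ℕ.suc (toℕ i) ℕ.< n
  descends (ℕ.suc n) i =
    ℕ.s≤s (ℕ.m∸n≤m n (toℕ i ℕ.+ 1 ℕ.* ℕ.suc (toℕ i)))

  nC0≡1 : ∀ n → n C 0 ≡ 1
  nC0≡1 n = trans (nCk≡nC[n∸k] {0} {n} ℕ.z≤n) (nCn≡1 n)

-- The j = 0 term of the defining relation is Eₙ itself; solving for it leaves
-- the terms j = i + 1 with i < ⌊n/2⌋.
E-step : ℤ → ∀ n → <-Rec (λ _ → ℤ) n → ℤ
E-step a n E< = (1ℤ - a) ^ n - ∑[ i < ⌊ n /2⌋ ]
  (let 2j = 2 ℕ.* ℕ.suc (toℕ i) in + (n C 2j) * a ^ 2j * E< (descends n i))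

E : ℤ → ℕ → ℤ
E a = <-rec (λ _ → ℤ) (E-step a)

private
  E-unfold : ∀ a n → E a n ≡ E-step a n (λ {m} _ → E a m)
  E-unfold a n = FixPoint.unfold-wfRec <-wellFounded (λ _ → ℤ) (E-step a)
    (λ m eq → cong (_-_ ((1ℤ - a) ^ m)) $ sum-cong-≗ λ i →
      cong (+ (m C (2 ℕ.* ℕ.suc (toℕ i))) * a ^ (2 ℕ.* ℕ.suc (toℕ i)) *_)
           (eq (descends m i))) {n}

E-recurrence : ∀ a n →
  ∑[ j ≤ ⌊ n /2⌋ ] (+ (n C (2 ℕ.* toℕ j)) * a ^ (2 ℕ.* toℕ j) * E a (n ℕ.∸ 2 ℕ.* toℕ j))
    ≡ (1ℤ - a) ^ n
E-recurrence a n = begin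
  + (n C 0) * 1ℤ * E a n + S   ≡⟨ cong (λ c → + c * 1ℤ * E a n + S) (nC0≡1 n) ⟩
  1ℤ * E a n + S               ≡⟨ cong (_+ S) (*-identityˡ (E a n)) ⟩
  E a n + S                    ≡⟨ cong (_+ S) (E-unfold a n) ⟩
  (1ℤ - a) ^ n - S + S         ≡⟨ solve 2 (λ x s → x :- s :+ s := x) refl _ S ⟩
  (1ℤ - a) ^ n                 ∎
  where
  open ≡-Reasoning
  open +-*-Solver
  S = ∑[ i < ⌊ n /2⌋ ] (let 2j = 2 ℕ.* ℕ.suc (toℕ i) in
        + (n C 2j) * a ^ 2j * E a (n ℕ.∸ 2j))

{-# OPTIONS --safe #-}
module Submission where

-- In exponential generating functions the recurrence reads cosh(at) E(t) = e^((1−a)t), so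
-- E(t) = e^t (1 − tanh(at)): Eₙ is the binomial transform of e_j = a^j S_j, where S_j are the
-- coefficients of 1 − tanh, namely 1, −1, 0, 2, 0, −16, 0, 272, 0, … with S_j = 0 for even j ≥ 2
-- and 16 ∣ S_j for j ≥ 5.
-- Hence E_{X+b} = Σ_j C(X,j) G_j with G_j = Σ_i C(b,i) e_{i+j} and G_0 = E_b.  For X = 2^m k the terms
-- with j ≥ 6 vanish modulo 2^(m+10), and G_1, …, G_5 only involve e_1, e_3, e_5, e_7 to the
-- required precision.  What remains is a congruence modulo 2^10 between polynomials in
-- a, b and X, which is settled by the parities of a/2 and b.

-- The obstacle is division by factorials: C(X,j) and C(b,i) become polynomials only after
-- multiplication by j! and i!. The odd parts are cleared once for all by 45 = lcm(9, 15), where 9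
-- comes from C(X,4) C(b,3) and 15 from C(X,5); being odd, 45 is cancelled at the end. Powers of 2
-- cannot be cancelled from a congruence modulo a power of 2 without loss, so they are accounted for
-- exactly: those in i! divide the coefficients 2, 16, 272 of e₃, e₅, e₇, and those in j! are taken
-- out of the even factors X, X - 2, X - 4. With X = 8r the terms are compared modulo r · 2^13 = X ·
-- 2^10, a multiple of 2^(m+10).

open import Defs
open import Data.Integer using (ℤ; +_; 0ℤ; 1ℤ; -1ℤ; _+_; _-_; -_; _*_; _^_; ∣_∣)
open import Data.Integer.Divisibility.Signed
  using (_∣_; divides; ∣ᵤ⇒∣; ∣⇒∣ᵤ; ∣-refl; ∣-trans; ∣m∣n⇒∣m+n; ∣m∣n⇒∣m-n; ∣m⇒∣m*n; ∣n⇒∣m*n; *-monoʳ-∣; *-monoˡ-∣)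
open import Data.Integer.DivMod using (_/ℕ_; _%ℕ_; a≡a%ℕn+[a/ℕn]*n; n%ℕd<d)
import Data.Integer.Properties as ℤ
open import Data.Integer.Tactic.RingSolver using (solve-∀)
open import Algebra.Properties.Monoid.Sum ℤ.+-0-monoid using (sum; sum-cong-≗; sum-syntax)
open import Data.Fin using (toℕ)
import Data.Nat as ℕ
open import Data.Nat using (ℕ; zero; suc; ⌊_/2⌋)
open import Data.Nat.Combinatorics using (_C_; nCk+nC[k+1]≡[n+1]C[k+1]; k>n⇒nCk≡0; nCn≡1; nCk≡nC[n∸k]; nC1≡n)
import Data.Nat.Divisibility as ℕ
open import Data.Nat.Induction using (<-rec)
import Data.Nat.Properties as ℕ
open import Data.Product using (_×_; _,_; proj₁; proj₂; ∃-syntax)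
open import Data.Sum using (_⊎_; inj₁; inj₂)
open import Function using (_∘_; const)
open import Relation.Binary.PropositionalEquality using (_≡_; _≢_; _≗_; refl; sym; trans; cong; cong₂; subst; subst₂; module ≡-Reasoning)
open import Relation.Nullary using (¬_; yes; no; contradiction)

open ≡-Reasoning

-- Sequences as exponential generating functions

-- A sequence f stands for its exponential generating function Σ f n tⁿ / n!: then D is d/dt,
-- ⋆ is the product (defined by the Leibniz rule) and δ is the constant 1.
D : (ℕ → ℤ) → ℕ → ℤ
D f = f ∘ suc

infixl 6 _⊕_
infixl 7 _⋆_

_⊕_ : (ℕ → ℤ) → (ℕ → ℤ) → ℕ → ℤ
(f ⊕ g) n = f n + g n

_⋆_ : (ℕ → ℤ) → (ℕ → ℤ) → ℕ → ℤ
(f ⋆ g) zero    = f 0 * g 0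
(f ⋆ g) (suc n) = (D f ⋆ g) n + (f ⋆ D g) n

δ : ℕ → ℤ
δ zero    = 1ℤ
δ (suc _) = 0ℤ

⋆-cong : ∀ {f f′ g g′} → f ≗ f′ → g ≗ g′ → f ⋆ g ≗ f′ ⋆ g′
⋆-cong p q zero    = cong₂ _*_ (p 0) (q 0)
⋆-cong p q (suc n) = cong₂ _+_ (⋆-cong (p ∘ suc) q n) (⋆-cong p (q ∘ suc) n)

⋆-congˡ : ∀ f {g g′} → g ≗ g′ → f ⋆ g ≗ f ⋆ g′
⋆-congˡ f = ⋆-cong {f} λ _ → refl

⋆-congʳ : ∀ g {f f′} → f ≗ f′ → f ⋆ g ≗ f′ ⋆ g
⋆-congʳ g p = ⋆-cong {g = g} p λ _ → refl

⋆-comm : ∀ f g → f ⋆ g ≗ g ⋆ f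
⋆-comm f g zero    = ℤ.*-comm (f 0) (g 0)
⋆-comm f g (suc n) = trans (ℤ.+-comm ((D f ⋆ g) n) _)
  (cong₂ _+_ (⋆-comm f (D g) n) (⋆-comm (D f) g n))

private
  +-interchange : ∀ w x y z → (w + x) + (y + z) ≡ (w + y) + (x + z)
  +-interchange = solve-∀

⋆-distribʳ-⊕ : ∀ h f g → (f ⊕ g) ⋆ h ≗ (f ⋆ h) ⊕ (g ⋆ h)
⋆-distribʳ-⊕ h f g zero    = ℤ.*-distribʳ-+ (h 0) (f 0) (g 0)
⋆-distribʳ-⊕ h f g (suc n) = trans
  (cong₂ _+_ (⋆-distribʳ-⊕ h (D f) (D g) n) (⋆-distribʳ-⊕ (D h) f g n))
  (+-interchange ((D f ⋆ h) n) _ _ _)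

⋆-distribˡ-⊕ : ∀ h f g → h ⋆ (f ⊕ g) ≗ (h ⋆ f) ⊕ (h ⋆ g)
⋆-distribˡ-⊕ h f g n = trans (⋆-comm h (f ⊕ g) n)
  (trans (⋆-distribʳ-⊕ h f g n) (cong₂ _+_ (⋆-comm f h n) (⋆-comm g h n)))

⋆-assoc : ∀ f g h → (f ⋆ g) ⋆ h ≗ f ⋆ (g ⋆ h)
⋆-assoc f g h zero    = ℤ.*-assoc (f 0) (g 0) (h 0)
⋆-assoc f g h (suc n) = begin
  (((D f ⋆ g) ⊕ (f ⋆ D g)) ⋆ h) n + ((f ⋆ g) ⋆ D h) n
    ≡⟨ cong (_+ ((f ⋆ g) ⋆ D h) n) (⋆-distribʳ-⊕ h (D f ⋆ g) (f ⋆ D g) n) ⟩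
  ((D f ⋆ g) ⋆ h) n + ((f ⋆ D g) ⋆ h) n + ((f ⋆ g) ⋆ D h) n
    ≡⟨ cong₂ _+_ (cong₂ _+_ (⋆-assoc (D f) g h n) (⋆-assoc f (D g) h n)) (⋆-assoc f g (D h) n) ⟩
  (D f ⋆ (g ⋆ h)) n + (f ⋆ (D g ⋆ h)) n + (f ⋆ (g ⋆ D h)) n
    ≡⟨ ℤ.+-assoc ((D f ⋆ (g ⋆ h)) n) _ _ ⟩
  (D f ⋆ (g ⋆ h)) n + ((f ⋆ (D g ⋆ h)) n + (f ⋆ (g ⋆ D h)) n)
    ≡⟨ cong (_+_ ((D f ⋆ (g ⋆ h)) n)) (⋆-distribˡ-⊕ f (D g ⋆ h) (g ⋆ D h) n) ⟨
  (D f ⋆ (g ⋆ h)) n + (f ⋆ ((D g ⋆ h) ⊕ (g ⋆ D h))) n ∎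

infixr 7 _·_

_·_ : ℤ → (ℕ → ℤ) → ℕ → ℤ
(c · f) n = c * f n

·-⋆ : ∀ c f g → (c · f) ⋆ g ≗ c · (f ⋆ g)
·-⋆ c f g zero    = ℤ.*-assoc c (f 0) (g 0)
·-⋆ c f g (suc n) = trans (cong₂ _+_ (·-⋆ c (D f) g n) (·-⋆ c f (D g) n))
  (sym (ℤ.*-distribˡ-+ c ((D f ⋆ g) n) _))

⋆-· : ∀ c f g → f ⋆ (c · g) ≗ c · (f ⋆ g)
⋆-· c f g n = trans (⋆-comm f (c · g) n)
  (trans (·-⋆ c g f n) (cong (c *_) (⋆-comm g f n)))

⋆-zeroˡ : ∀ f → const 0ℤ ⋆ f ≗ const 0ℤ
⋆-zeroˡ f zero    = ℤ.*-zeroˡ (f 0)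
⋆-zeroˡ f (suc n) = cong₂ _+_ (⋆-zeroˡ f n) (⋆-zeroˡ (D f) n)

⋆-identityˡ : ∀ f → δ ⋆ f ≗ f
⋆-identityˡ f zero    = ℤ.*-identityˡ (f 0)
⋆-identityˡ f (suc n) = trans (cong₂ _+_ (⋆-zeroˡ f n) (⋆-identityˡ (D f) n)) (ℤ.+-identityˡ _)

⋆-identityʳ : ∀ f → f ⋆ δ ≗ f
⋆-identityʳ f n = trans (⋆-comm f δ n) (⋆-identityˡ f n)

scale : ℤ → (ℕ → ℤ) → ℕ → ℤ
scale a f n = a ^ n * f n

scale-⋆ : ∀ a f g → scale a (f ⋆ g) ≗ scale a f ⋆ scale a g
scale-⋆ a f g zero    = identity (f 0) (g 0)
  where
  identity : ∀ x y → 1ℤ * (x * y) ≡ (1ℤ * x) * (1ℤ * y)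
  identity = solve-∀
scale-⋆ a f g (suc n) = begin
  a * a ^ n * ((D f ⋆ g) n + (f ⋆ D g) n)
    ≡⟨ distribute a (a ^ n) ((D f ⋆ g) n) _ ⟩
  a * scale a (D f ⋆ g) n + a * scale a (f ⋆ D g) n
    ≡⟨ cong₂ (λ x y → a * x + a * y) (scale-⋆ a (D f) g n) (scale-⋆ a f (D g) n) ⟩
  a * (scale a (D f) ⋆ scale a g) n + a * (scale a f ⋆ scale a (D g)) n
    ≡⟨ cong₂ _+_ (·-⋆ a (scale a (D f)) (scale a g) n) (⋆-· a (scale a f) (scale a (D g)) n) ⟨
  ((a · scale a (D f)) ⋆ scale a g) n + (scale a f ⋆ (a · scale a (D g))) n
    ≡⟨ cong₂ _+_ (⋆-congʳ (scale a g) (D-scale f) n) (⋆-congˡ (scale a f) (D-scale g) n) ⟨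
  (D (scale a f) ⋆ scale a g) n + (scale a f ⋆ D (scale a g)) n ∎
  where
  distribute : ∀ a p x y → a * p * (x + y) ≡ a * (p * x) + a * (p * y)
  distribute = solve-∀
  D-scale : ∀ f → D (scale a f) ≗ a · scale a (D f)
  D-scale f k = ℤ.*-assoc a (a ^ k) (f (suc k))

geometric-⋆ : ∀ r s → (r ^_) ⋆ (s ^_) ≗ ((r + s) ^_)
geometric-⋆ r s zero    = refl
geometric-⋆ r s (suc n) = begin
  ((r · (r ^_)) ⋆ (s ^_)) n + ((r ^_) ⋆ (s · (s ^_))) n
    ≡⟨ cong₂ _+_ (·-⋆ r (r ^_) (s ^_) n) (⋆-· s (r ^_) (s ^_) n) ⟩
  r * ((r ^_) ⋆ (s ^_)) n + s * ((r ^_) ⋆ (s ^_)) n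
    ≡⟨ ℤ.*-distribʳ-+ (((r ^_) ⋆ (s ^_)) n) r s ⟨
  (r + s) * ((r ^_) ⋆ (s ^_)) n
    ≡⟨ cong ((r + s) *_) (geometric-⋆ r s n) ⟩
  (r + s) ^ suc n ∎

sumTo-extend : ∀ (f : ℕ → ℤ) n → f n ≡ 0ℤ →
  ∑[ i < suc n ] f (toℕ i) ≡ ∑[ i < n ] f (toℕ i)
sumTo-extend f zero    p = trans (ℤ.+-identityʳ (f 0)) p
sumTo-extend f (suc n) p = cong (_+_ (f 0)) (sumTo-extend (D f) n p)

sum-+ : ∀ (f g : ℕ → ℤ) n → ∑[ i < n ] (f (toℕ i) + g (toℕ i)) ≡ ∑[ i < n ] f (toℕ i) + ∑[ i < n ] g (toℕ i)
sum-+ f g zero    = refl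
sum-+ f g (suc n) = trans (cong (_+_ (f 0 + g 0)) (sum-+ (D f) (D g) n)) (+-interchange (f 0) _ _ _)

nC0≡1 : ∀ n → n C 0 ≡ 1
nC0≡1 n = trans (nCk≡nC[n∸k] {0} {n} ℕ.z≤n) (nCn≡1 n)

-- The bridge from the recursive product to the sum in the recurrence of `E`. The Leibniz rule
-- becomes Pascal's rule: its two halves contribute C(n,k) and C(n,k+1) to the coefficient of
-- `f (suc k)`.
⋆-binomial : ∀ f g n → (f ⋆ g) n ≡ ∑[ k < suc n ] (+ (n C toℕ k) * f (toℕ k) * g (n ℕ.∸ toℕ k))
⋆-binomial f g zero    = identity (f 0) (g 0)
  where
  identity : ∀ x y → x * y ≡ 1ℤ * x * y + 0ℤ
  identity = solve-∀
⋆-binomial f g (suc n) = begin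
  (D f ⋆ g) n + (f ⋆ D g) n
    ≡⟨ cong₂ _+_ (⋆-binomial (D f) g n) (⋆-binomial f (D g) n) ⟩
  ∑[ k < suc n ] shifted (toℕ k) + ∑[ k < suc n ] (+ (n C toℕ k) * f (toℕ k) * g (suc (n ℕ.∸ toℕ k)))
    ≡⟨ cong (_+_ (sum {suc n} (shifted ∘ toℕ))) (trans (sum-cong-≗ {suc n} (λ k → suc-∸ (toℕ k)))
        (sym (sumTo-extend unshifted (suc n) (vanish (ℕ.n<1+n n))))) ⟩
  ∑[ k < suc n ] shifted (toℕ k) + (unshifted 0 + ∑[ k < suc n ] unshifted (suc (toℕ k)))
    ≡⟨ rearrange (sum {suc n} (shifted ∘ toℕ)) (unshifted 0) _ ⟩
  unshifted 0 + (∑[ k < suc n ] shifted (toℕ k) + ∑[ k < suc n ] unshifted (suc (toℕ k)))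
    ≡⟨ cong (_+_ (unshifted 0)) (sym (sum-+ shifted (unshifted ∘ suc) (suc n))) ⟩
  unshifted 0 + ∑[ k < suc n ] (shifted (toℕ k) + unshifted (suc (toℕ k)))
    ≡⟨ cong₂ _+_ (cong (λ c → + c * f 0 * g (suc n)) (trans (nC0≡1 n) (sym (nC0≡1 (suc n))))) (sum-cong-≗ {suc n} (λ k → pascal (toℕ k))) ⟩
  ∑[ k < suc (suc n) ] (+ (suc n C toℕ k) * f (toℕ k) * g (suc n ℕ.∸ toℕ k)) ∎
  where
  shifted unshifted : ℕ → ℤ
  shifted k   = + (n C k) * f (suc k) * g (n ℕ.∸ k)
  unshifted k = + (n C k) * f k * g (suc n ℕ.∸ k)
  vanish : ∀ {k} {x} → n ℕ.< k → + (n C k) * f k * x ≡ 0ℤ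
  vanish {k} {x} n<k = cong (λ c → + c * f k * x) (k>n⇒nCk≡0 n<k)
  suc-∸ : ∀ k → + (n C k) * f k * g (suc (n ℕ.∸ k)) ≡ unshifted k
  -- For k > n the two truncated differences disagree, but there the binomial coefficient is zero.
  suc-∸ k with k ℕ.≤? n
  ... | yes k≤n = cong (λ i → + (n C k) * f k * g i) (sym (ℕ.+-∸-assoc 1 k≤n))
  ... | no  k≰n = trans (vanish (ℕ.≰⇒> k≰n)) (sym (vanish (ℕ.≰⇒> k≰n)))
  rearrange : ∀ x y z → x + (y + z) ≡ y + (x + z)
  rearrange = solve-∀
  factor : ∀ x y p q → x * p * q + y * p * q ≡ (x + y) * p * q
  factor = solve-∀
  pascal : ∀ k → shifted k + unshifted (suc k) ≡ + (suc n C suc k) * f (suc k) * g (n ℕ.∸ k)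
  pascal k = trans (factor (+ (n C k)) (+ (n C suc k)) (f (suc k)) (g (n ℕ.∸ k)))
    (cong (λ c → + c * f (suc k) * g (n ℕ.∸ k)) (nCk+nC[k+1]≡[n+1]C[k+1] n k))

-- The coefficients of 1 − tanh

sumTo-even : ∀ (f : ℕ → ℤ) n → (∀ j → f (suc (2 ℕ.* j)) ≡ 0ℤ) →
  ∑[ k < suc n ] f (toℕ k) ≡ ∑[ j < suc ⌊ n /2⌋ ] f (2 ℕ.* toℕ j)
sumTo-even f zero          odd≡0 = refl
sumTo-even f (suc zero)    odd≡0 = cong (λ x → f 0 + (x + 0ℤ)) (odd≡0 0)
sumTo-even f (suc (suc n)) odd≡0 = cong (_+_ (f 0)) (begin
  f 1 + ∑[ k < suc n ] f (2 ℕ.+ toℕ k)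
    ≡⟨ cong₂ _+_ (odd≡0 0) (sumTo-even (D (D f)) n λ j → trans (cong (f ∘ suc) (sym (ℕ.*-suc 2 j))) (odd≡0 (suc j))) ⟩
  0ℤ + ∑[ j < suc ⌊ n /2⌋ ] f (2 ℕ.+ 2 ℕ.* toℕ j)
    ≡⟨ ℤ.+-identityˡ _ ⟩
  ∑[ j < suc ⌊ n /2⌋ ] f (2 ℕ.+ 2 ℕ.* toℕ j)
    ≡⟨ sum-cong-≗ {suc ⌊ n /2⌋} (λ j → cong f (sym (ℕ.*-suc 2 (toℕ j)))) ⟩
  ∑[ j < suc ⌊ n /2⌋ ] f (2 ℕ.* suc (toℕ j)) ∎)

cosh sinh : ℕ → ℤ
cosh zero          = 1ℤ
cosh (suc zero)    = 0ℤ
cosh (suc (suc n)) = cosh n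
sinh = D cosh

opaque
  -- At a = 1 the right-hand side of the recurrence is 0ⁿ, so `E 1ℤ` is itself the inverse of
  -- `cosh`.
  sech tanh : ℕ → ℤ
  sech = E 1ℤ
  tanh = sech ⋆ sinh

cosh-even : ∀ j → cosh (2 ℕ.* j) ≡ 1ℤ
cosh-even zero    = refl
cosh-even (suc j) = trans (cong cosh (ℕ.*-suc 2 j)) (cosh-even j)

cosh-odd : ∀ j → cosh (suc (2 ℕ.* j)) ≡ 0ℤ
cosh-odd zero    = refl
cosh-odd (suc j) = trans (cong (cosh ∘ suc) (ℕ.*-suc 2 j)) (cosh-odd j)

cosh-⋆-E : ∀ a → scale a cosh ⋆ E a ≗ ((1ℤ - a) ^_)
cosh-⋆-E a n = begin
  (scale a cosh ⋆ E a) n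
    ≡⟨ ⋆-binomial (scale a cosh) (E a) n ⟩
  ∑[ k < suc n ] term (toℕ k)
    ≡⟨ sumTo-even term n term-odd ⟩
  ∑[ j < suc ⌊ n /2⌋ ] term (2 ℕ.* toℕ j)
    ≡⟨ sum-cong-≗ {suc ⌊ n /2⌋} (λ j → term-even (toℕ j)) ⟩
  ∑[ j < suc ⌊ n /2⌋ ] (+ (n C (2 ℕ.* toℕ j)) * a ^ (2 ℕ.* toℕ j) * E a (n ℕ.∸ 2 ℕ.* toℕ j))
    ≡⟨ E-recurrence a n ⟩
  (1ℤ - a) ^ n ∎
  where
  term : ℕ → ℤ
  term k = + (n C k) * scale a cosh k * E a (n ℕ.∸ k)
  vanish : ∀ x y z → x * (y * 0ℤ) * z ≡ 0ℤ
  vanish = solve-∀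
  term-odd : ∀ j → term (suc (2 ℕ.* j)) ≡ 0ℤ
  term-odd j = trans (cong (λ c → + (n C k) * (a ^ k * c) * E a (n ℕ.∸ k)) (cosh-odd j))
    (vanish (+ (n C k)) (a ^ k) (E a (n ℕ.∸ k)))
    where k = suc (2 ℕ.* j)
  term-even : ∀ j → term (2 ℕ.* j) ≡ + (n C (2 ℕ.* j)) * a ^ (2 ℕ.* j) * E a (n ℕ.∸ 2 ℕ.* j)
  term-even j = cong (λ c → + (n C (2 ℕ.* j)) * c * E a (n ℕ.∸ 2 ℕ.* j))
    (trans (cong (a ^ (2 ℕ.* j) *_) (cosh-even j)) (ℤ.*-identityʳ _))

scale-cong : ∀ a {f g} → f ≗ g → scale a f ≗ scale a g
scale-cong a f≗g n = cong (a ^ n *_) (f≗g n)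

scale-δ : ∀ a → scale a δ ≗ δ
scale-δ a zero    = refl
scale-δ a (suc n) = ℤ.*-zeroʳ (a ^ suc n)

opaque
  unfolding sech

  sech-⋆-cosh : sech ⋆ cosh ≗ δ
  sech-⋆-cosh n = begin
    (sech ⋆ cosh) n          ≡⟨ ⋆-comm sech cosh n ⟩
    (cosh ⋆ sech) n          ≡⟨ ⋆-congʳ sech (λ k → trans (sym (ℤ.*-identityˡ _)) (cong (_* cosh k) (sym (ℤ.^-zeroˡ k)))) n ⟩
    (scale 1ℤ cosh ⋆ sech) n ≡⟨ cosh-⋆-E 1ℤ n ⟩
    0ℤ ^ n                   ≡⟨ 0^ n ⟩
    δ n ∎
    where
    0^ : ∀ n → 0ℤ ^ n ≡ δ n
    0^ zero    = refl
    0^ (suc n) = refl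

1-tanh : ℕ → ℤ
1-tanh = δ ⊕ (-1ℤ · tanh)

opaque
  unfolding tanh

  sech-⋆-exp : sech ⋆ (-1ℤ ^_) ≗ 1-tanh
  sech-⋆-exp n = begin
    (sech ⋆ (-1ℤ ^_)) n                          ≡⟨ ⋆-congˡ sech (proj₁ ∘ exp) n ⟩
    (sech ⋆ (cosh ⊕ (-1ℤ · sinh))) n             ≡⟨ ⋆-distribˡ-⊕ sech cosh (-1ℤ · sinh) n ⟩
    (sech ⋆ cosh) n + (sech ⋆ (-1ℤ · sinh)) n    ≡⟨ cong₂ _+_ (sech-⋆-cosh n) (⋆-· -1ℤ sech sinh n) ⟩
    1-tanh n ∎
    where
    negate : ∀ x y → -1ℤ * (x + -1ℤ * y) ≡ y + -1ℤ * x
    negate = solve-∀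
    -- e^(-t) = cosh t - sinh t. Two consecutive coefficients are proved together because
    -- differentiation exchanges `cosh` and `sinh`.
    exp : ∀ n → (-1ℤ ^ n ≡ cosh n + -1ℤ * sinh n) × (-1ℤ ^ suc n ≡ sinh n + -1ℤ * cosh n)
    exp zero    = refl , refl
    exp (suc n) = proj₂ (exp n) ,
      trans (cong (-1ℤ *_) (proj₂ (exp n))) (negate (sinh n) (cosh n))

-- Multiplying cosh(at) E = e^(-at) e^t by sech(at) isolates E, and sech(at) e^(-at) is 1 -
-- tanh(at).
E≗1-tanh : ∀ a → E a ≗ scale a 1-tanh ⋆ const 1ℤ
E≗1-tanh a n = begin
  E a n
    ≡⟨ ⋆-identityˡ (E a) n ⟨
  (δ ⋆ E a) n
    ≡⟨ ⋆-congʳ (E a) unit n ⟨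
  ((scale a sech ⋆ scale a cosh) ⋆ E a) n
    ≡⟨ ⋆-assoc (scale a sech) (scale a cosh) (E a) n ⟩
  (scale a sech ⋆ (scale a cosh ⋆ E a)) n
    ≡⟨ ⋆-congˡ (scale a sech) exp n ⟩
  (scale a sech ⋆ (scale a (-1ℤ ^_) ⋆ const 1ℤ)) n
    ≡⟨ ⋆-assoc (scale a sech) (scale a (-1ℤ ^_)) (const 1ℤ) n ⟨
  ((scale a sech ⋆ scale a (-1ℤ ^_)) ⋆ const 1ℤ) n
    ≡⟨ ⋆-congʳ (const 1ℤ) (λ k → trans (sym (scale-⋆ a sech (-1ℤ ^_) k)) (scale-cong a sech-⋆-exp k)) n ⟩
  (scale a 1-tanh ⋆ const 1ℤ) n ∎
  where
  unit : scale a sech ⋆ scale a cosh ≗ δ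
  unit k = trans (sym (scale-⋆ a sech cosh k)) (trans (scale-cong a sech-⋆-cosh k) (scale-δ a k))
  -a^ : ∀ k → (- a) ^ k ≡ a ^ k * -1ℤ ^ k
  -a^ zero    = refl
  -a^ (suc k) = trans (cong (- a *_) (-a^ k)) (shuffle a (a ^ k) (-1ℤ ^ k))
    where
    shuffle : ∀ a x y → - a * (x * y) ≡ a * x * (-1ℤ * y)
    shuffle = solve-∀
  exp : scale a cosh ⋆ E a ≗ scale a (-1ℤ ^_) ⋆ const 1ℤ
  exp k = begin
    (scale a cosh ⋆ E a) k             ≡⟨ cosh-⋆-E a k ⟩
    (1ℤ - a) ^ k                       ≡⟨ cong (_^ k) (ℤ.+-comm 1ℤ (- a)) ⟩
    (- a + 1ℤ) ^ k                     ≡⟨ geometric-⋆ (- a) 1ℤ k ⟨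
    (((- a) ^_) ⋆ (1ℤ ^_)) k           ≡⟨ ⋆-cong -a^ ℤ.^-zeroˡ k ⟩
    (scale a (-1ℤ ^_) ⋆ const 1ℤ) k ∎

-- Derivatives of sech and tanh

opaque
  unfolding tanh

  -- `sech` is known only through `sech-⋆-cosh`, so its derivative is found by differentiating that
  -- identity and multiplying the result by `sech`.
  D-sech : D sech ≗ -1ℤ · (tanh ⋆ sech)
  D-sech n = begin
    D sech n                           ≡⟨ ⋆-identityˡ (D sech) n ⟨
    (δ ⋆ D sech) n                     ≡⟨ ⋆-congʳ (D sech) sech-⋆-cosh n ⟨
    ((sech ⋆ cosh) ⋆ D sech) n         ≡⟨ ⋆-assoc sech cosh (D sech) n ⟩
    (sech ⋆ (cosh ⋆ D sech)) n         ≡⟨ ⋆-congˡ sech derivative n ⟩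
    (sech ⋆ (-1ℤ · (sinh ⋆ sech))) n   ≡⟨ ⋆-· -1ℤ sech (sinh ⋆ sech) n ⟩
    -1ℤ * (sech ⋆ (sinh ⋆ sech)) n     ≡⟨ cong (-1ℤ *_) (⋆-assoc sech sinh sech n) ⟨
    -1ℤ * (tanh ⋆ sech) n ∎
    where
    solve-sum : ∀ {x y} → x + y ≡ 0ℤ → y ≡ -1ℤ * x
    solve-sum {x} {y} p = trans (identity x y) (trans (cong (λ z → z + -1ℤ * x) p) (ℤ.+-identityˡ _))
      where
      identity : ∀ x y → y ≡ x + y + -1ℤ * x
      identity = solve-∀
    derivative : cosh ⋆ D sech ≗ -1ℤ · (sinh ⋆ sech)
    derivative k = solve-sum (trans (⋆-comm cosh sech (suc k)) (sech-⋆-cosh (suc k)))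

  D-tanh : D tanh ≗ δ ⊕ (-1ℤ · (tanh ⋆ tanh))
  D-tanh n = begin
    (D sech ⋆ sinh) n + (sech ⋆ cosh) n
      ≡⟨ ℤ.+-comm ((D sech ⋆ sinh) n) _ ⟩
    (sech ⋆ cosh) n + (D sech ⋆ sinh) n
      ≡⟨ cong₂ _+_ (sech-⋆-cosh n) (begin
        (D sech ⋆ sinh) n                   ≡⟨ ⋆-congʳ sinh D-sech n ⟩
        ((-1ℤ · (tanh ⋆ sech)) ⋆ sinh) n    ≡⟨ ·-⋆ -1ℤ (tanh ⋆ sech) sinh n ⟩
        -1ℤ * ((tanh ⋆ sech) ⋆ sinh) n      ≡⟨ cong (-1ℤ *_) (⋆-assoc tanh sech sinh n) ⟩
        -1ℤ * (tanh ⋆ tanh) n ∎) ⟩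
    δ n + -1ℤ * (tanh ⋆ tanh) n ∎

-- U k = (tanh′)ᵏ and V k = tanh (tanh′)ᵏ.  Since tanh² = 1 − tanh′, differentiation maps the
-- span of these to itself, which gives all higher derivatives of tanh.
U V : ℕ → ℕ → ℤ
U zero    = δ
U (suc k) = D tanh ⋆ U k
V k       = tanh ⋆ U k

D²-tanh : D (D tanh) ≗ - + 2 · (tanh ⋆ D tanh)
D²-tanh n = begin
  D (D tanh) n                                              ≡⟨ D-tanh (suc n) ⟩
  0ℤ + -1ℤ * ((D tanh ⋆ tanh) n + (tanh ⋆ D tanh) n)        ≡⟨ cong (λ x → 0ℤ + -1ℤ * (x + (tanh ⋆ D tanh) n)) (⋆-comm (D tanh) tanh n) ⟩
  0ℤ + -1ℤ * ((tanh ⋆ D tanh) n + (tanh ⋆ D tanh) n)        ≡⟨ double ((tanh ⋆ D tanh) n) ⟩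
  - + 2 * (tanh ⋆ D tanh) n ∎
  where
  double : ∀ x → 0ℤ + -1ℤ * (x + x) ≡ - + 2 * x
  double = solve-∀

-- The power rule combined with tanh″ = -2 tanh tanh′.
D-U : ∀ k → D (U k) ≗ - (+ 2 * + k) · V k
D-U zero    n = refl
D-U (suc k) n = begin
  (D (D tanh) ⋆ U k) n + (D tanh ⋆ D (U k)) n
    ≡⟨ cong₂ _+_ left right ⟩
  - + 2 * V (suc k) n + - (+ 2 * + k) * V (suc k) n
    ≡⟨ combine (+ k) (V (suc k) n) ⟩
  - (+ 2 * + suc k) * V (suc k) n ∎
  where
  combine : ∀ k x → - + 2 * x + - (+ 2 * k) * x ≡ - (+ 2 * (1ℤ + k)) * x
  combine = solve-∀
  left : (D (D tanh) ⋆ U k) n ≡ - + 2 * V (suc k) n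
  left = begin
    (D (D tanh) ⋆ U k) n                  ≡⟨ ⋆-congʳ (U k) D²-tanh n ⟩
    ((- + 2 · (tanh ⋆ D tanh)) ⋆ U k) n   ≡⟨ ·-⋆ (- + 2) (tanh ⋆ D tanh) (U k) n ⟩
    - + 2 * ((tanh ⋆ D tanh) ⋆ U k) n     ≡⟨ cong (- + 2 *_) (⋆-assoc tanh (D tanh) (U k) n) ⟩
    - + 2 * V (suc k) n ∎
  right : (D tanh ⋆ D (U k)) n ≡ - (+ 2 * + k) * V (suc k) n
  right = begin
    (D tanh ⋆ D (U k)) n                           ≡⟨ ⋆-congˡ (D tanh) (D-U k) n ⟩
    (D tanh ⋆ (- (+ 2 * + k) · V k)) n             ≡⟨ ⋆-· (- (+ 2 * + k)) (D tanh) (V k) n ⟩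
    - (+ 2 * + k) * (D tanh ⋆ (tanh ⋆ U k)) n      ≡⟨ cong (- (+ 2 * + k) *_) (begin
      (D tanh ⋆ (tanh ⋆ U k)) n    ≡⟨ ⋆-assoc (D tanh) tanh (U k) n ⟨
      ((D tanh ⋆ tanh) ⋆ U k) n    ≡⟨ ⋆-congʳ (U k) (⋆-comm (D tanh) tanh) n ⟩
      ((tanh ⋆ D tanh) ⋆ U k) n    ≡⟨ ⋆-assoc tanh (D tanh) (U k) n ⟩
      V (suc k) n ∎) ⟩
    - (+ 2 * + k) * V (suc k) n ∎

D-V : ∀ k → D (V k) ≗ (1ℤ + + 2 * + k) · U (suc k) ⊕ - (+ 2 * + k) · U k
D-V k n = begin
  U (suc k) n + (tanh ⋆ D (U k)) n
    ≡⟨ cong (_+_ (U (suc k) n)) (begin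
      (tanh ⋆ D (U k)) n                         ≡⟨ ⋆-congˡ tanh (D-U k) n ⟩
      (tanh ⋆ (- (+ 2 * + k) · V k)) n           ≡⟨ ⋆-· (- (+ 2 * + k)) tanh (V k) n ⟩
      - (+ 2 * + k) * (tanh ⋆ V k) n             ≡⟨ cong (- (+ 2 * + k) *_) (begin
        (tanh ⋆ (tanh ⋆ U k)) n                    ≡⟨ ⋆-assoc tanh tanh (U k) n ⟨
        ((tanh ⋆ tanh) ⋆ U k) n                    ≡⟨ ⋆-congʳ (U k) tanh² n ⟩
        ((δ ⊕ -1ℤ · D tanh) ⋆ U k) n               ≡⟨ ⋆-distribʳ-⊕ (U k) δ (-1ℤ · D tanh) n ⟩
        (δ ⋆ U k) n + ((-1ℤ · D tanh) ⋆ U k) n     ≡⟨ cong₂ _+_ (⋆-identityˡ (U k) n) (·-⋆ -1ℤ (D tanh) (U k) n) ⟩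
        U k n + -1ℤ * U (suc k) n ∎) ⟩
      - (+ 2 * + k) * (U k n + -1ℤ * U (suc k) n) ∎) ⟩
  U (suc k) n + - (+ 2 * + k) * (U k n + -1ℤ * U (suc k) n)
    ≡⟨ combine (+ k) (U k n) (U (suc k) n) ⟩
  (1ℤ + + 2 * + k) * U (suc k) n + - (+ 2 * + k) * U k n ∎
  where
  combine : ∀ k x y → y + - (+ 2 * k) * (x + -1ℤ * y) ≡ (1ℤ + + 2 * k) * y + - (+ 2 * k) * x
  combine = solve-∀
  tanh² : tanh ⋆ tanh ≗ δ ⊕ -1ℤ · D tanh
  tanh² m = trans (identity (δ m) ((tanh ⋆ tanh) m)) (cong (λ x → δ m + -1ℤ * x) (sym (D-tanh m)))
    where
    identity : ∀ x y → y ≡ x + -1ℤ * (x + -1ℤ * y)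
    identity = solve-∀

opaque
  unfolding tanh

  tanh-0 : tanh 0 ≡ 0ℤ
  tanh-0 = ℤ.*-zeroʳ (sech 0)

U-0 : ∀ k → U k 0 ≡ 1ℤ
U-0 zero    = refl
U-0 (suc k) = cong₂ _*_ (trans (D-tanh 0) (cong (λ x → 1ℤ + -1ℤ * (x * x)) tanh-0)) (U-0 k)

V-0 : ∀ k → V k 0 ≡ 0ℤ
V-0 k = cong (_* U k 0) tanh-0

-- tanh is an odd function and tanh′ an even one. The derivative formulas send each claim to the
-- other family at the preceding index, down to tanh(0) = 0.
U-odd : ∀ j k → U k (suc (2 ℕ.* j)) ≡ 0ℤ
V-even : ∀ j k → V k (2 ℕ.* j) ≡ 0ℤ
U-odd j k = trans (D-U k (2 ℕ.* j)) (trans (cong (- (+ 2 * + k) *_) (V-even j k)) (ℤ.*-zeroʳ (- (+ 2 * + k))))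
V-even zero    k = V-0 k
V-even (suc j) k = begin
  V k (2 ℕ.* suc j)
    ≡⟨ cong (V k) (ℕ.*-suc 2 j) ⟩
  V k (suc (suc (2 ℕ.* j)))
    ≡⟨ D-V k (suc (2 ℕ.* j)) ⟩
  (1ℤ + + 2 * + k) * U (suc k) (suc (2 ℕ.* j)) + - (+ 2 * + k) * U k (suc (2 ℕ.* j))
    ≡⟨ cong₂ (λ x y → (1ℤ + + 2 * + k) * x + - (+ 2 * + k) * y) (U-odd j (suc k)) (U-odd j k) ⟩
  (1ℤ + + 2 * + k) * 0ℤ + - (+ 2 * + k) * 0ℤ
    ≡⟨ cong₂ _+_ (ℤ.*-zeroʳ (1ℤ + + 2 * + k)) (ℤ.*-zeroʳ (- (+ 2 * + k))) ⟩
  0ℤ ∎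

D-tanh≗U : D tanh ≗ U 1
D-tanh≗U n = sym (⋆-identityʳ (D tanh) n)

tanh-even : ∀ j → tanh (2 ℕ.* j) ≡ 0ℤ
tanh-even zero    = tanh-0
tanh-even (suc j) = trans (cong tanh (ℕ.*-suc 2 j)) (trans (D-tanh≗U (suc (2 ℕ.* j))) (U-odd j 1))

tanh-3+ : ∀ n → tanh (3 ℕ.+ n) ≡ - + 6 * U 2 n + + 4 * U 1 n
tanh-3+ n = begin
  tanh (3 ℕ.+ n)                                              ≡⟨ D-tanh≗U (2 ℕ.+ n) ⟩
  U 1 (2 ℕ.+ n)                                               ≡⟨ D-U 1 (suc n) ⟩
  - + 2 * V 1 (suc n)                                         ≡⟨ cong (- + 2 *_) (D-V 1 n) ⟩
  - + 2 * (+ 3 * U 2 n + - + 2 * U 1 n)                       ≡⟨ combine (U 1 n) (U 2 n) ⟩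
  - + 6 * U 2 n + + 4 * U 1 n ∎
  where
  combine : ∀ x y → - + 2 * (+ 3 * y + - + 2 * x) ≡ - + 6 * y + + 4 * x
  combine = solve-∀

tanh-5+ : ∀ n → tanh (5 ℕ.+ n) ≡ + 120 * U 3 n - + 120 * U 2 n + + 16 * U 1 n
tanh-5+ n = begin
  tanh (5 ℕ.+ n)
    ≡⟨ tanh-3+ (2 ℕ.+ n) ⟩
  - + 6 * U 2 (2 ℕ.+ n) + + 4 * U 1 (2 ℕ.+ n)
    ≡⟨ cong₂ (λ x y → - + 6 * x + + 4 * y) (D-U 2 (suc n)) (D-U 1 (suc n)) ⟩
  - + 6 * (- + 4 * V 2 (suc n)) + + 4 * (- + 2 * V 1 (suc n))
    ≡⟨ cong₂ (λ x y → - + 6 * (- + 4 * x) + + 4 * (- + 2 * y)) (D-V 2 n) (D-V 1 n) ⟩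
  - + 6 * (- + 4 * (+ 5 * U 3 n + - + 4 * U 2 n)) + + 4 * (- + 2 * (+ 3 * U 2 n + - + 2 * U 1 n))
    ≡⟨ combine (U 1 n) (U 2 n) (U 3 n) ⟩
  + 120 * U 3 n - + 120 * U 2 n + + 16 * U 1 n ∎
  where
  combine : ∀ x y z → - + 6 * (- + 4 * (+ 5 * z + - + 4 * y)) + + 4 * (- + 2 * (+ 3 * y + - + 2 * x))
    ≡ + 120 * z - + 120 * y + + 16 * x
  combine = solve-∀

tanh-6+ : ∀ n → tanh (6 ℕ.+ n) ≡ (- + 45 * V 3 n + + 30 * V 2 n - + 2 * V 1 n) * + 16
tanh-6+ n = begin
  tanh (6 ℕ.+ n)
    ≡⟨ tanh-5+ (suc n) ⟩
  + 120 * U 3 (suc n) - + 120 * U 2 (suc n) + + 16 * U 1 (suc n)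
    ≡⟨ cong₂ _+_ (cong₂ (λ x y → + 120 * x - + 120 * y) (D-U 3 n) (D-U 2 n)) (cong (+ 16 *_) (D-U 1 n)) ⟩
  + 120 * (- + 6 * V 3 n) - + 120 * (- + 4 * V 2 n) + + 16 * (- + 2 * V 1 n)
    ≡⟨ combine (V 1 n) (V 2 n) (V 3 n) ⟩
  (- + 45 * V 3 n + + 30 * V 2 n - + 2 * V 1 n) * + 16 ∎
  where
  combine : ∀ x y z → + 120 * (- + 6 * z) - + 120 * (- + 4 * y) + + 16 * (- + 2 * x)
    ≡ (- + 45 * z + + 30 * y - + 2 * x) * + 16
  combine = solve-∀

tanh-1 : tanh 1 ≡ 1ℤ
tanh-1 = trans (D-tanh≗U 0) (U-0 1)

tanh-3 : tanh 3 ≡ - + 2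
tanh-3 = trans (tanh-3+ 0) (cong₂ (λ x y → - + 6 * x + + 4 * y) (U-0 2) (U-0 1))

tanh-5 : tanh 5 ≡ + 16
tanh-5 = trans (tanh-5+ 0) (cong₂ _+_ (cong₂ (λ x y → + 120 * x - + 120 * y) (U-0 3) (U-0 2)) (cong (+ 16 *_) (U-0 1)))

tanh-7 : tanh 7 ≡ - + 272
tanh-7 = begin
  tanh 7
    ≡⟨ tanh-6+ 1 ⟩
  (- + 45 * V 3 1 + + 30 * V 2 1 - + 2 * V 1 1) * + 16
    ≡⟨ cong₂ (λ x y → (x - + 2 * y) * + 16)
        (cong₂ (λ x y → - + 45 * x + + 30 * y) (V-1 3) (V-1 2)) (V-1 1) ⟩
  - + 272 ∎
  where
  collapse : ∀ k → (1ℤ + + 2 * k) * 1ℤ + - (+ 2 * k) * 1ℤ ≡ 1ℤ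
  collapse = solve-∀
  V-1 : ∀ k → V k 1 ≡ 1ℤ
  V-1 k = trans (D-V k 0) (trans (cong₂ (λ x y → (1ℤ + + 2 * + k) * x + - (+ 2 * + k) * y) (U-0 (suc k)) (U-0 k)) (collapse (+ k)))

-- The coefficients 120, -120, 16 of the fifth derivative are all divisible only by 8. One more
-- derivative supplies the missing factor 2, since `D-U` carries an even coefficient; at index 5
-- itself the value is 120 - 120 + 16.
16∣tanh : ∀ n → + 16 ∣ tanh (5 ℕ.+ n)
16∣tanh zero    = divides 1ℤ tanh-5
16∣tanh (suc n) = divides (- + 45 * V 3 n + + 30 * V 2 n - + 2 * V 1 n) (tanh-6+ n)

-- Binomial transforms modulo d, and 2-adic valuations of binomial coefficients

≡⇒≡mod : ∀ {d x y} → x ≡ y → x ≡ y [mod d ]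
≡⇒≡mod {x = x} refl = divides 0ℤ (ℤ.+-inverseʳ x)

mod-trans : ∀ {d} x y z → x ≡ y [mod d ] → y ≡ z [mod d ] → x ≡ z [mod d ]
mod-trans {d} x y z p q = subst (d ∣_) (identity x y z) (∣m∣n⇒∣m+n p q)
  where
  identity : ∀ x y z → x - y + (y - z) ≡ x - z
  identity = solve-∀

mod-+ : ∀ {d x x′ y y′} → x ≡ x′ [mod d ] → y ≡ y′ [mod d ] → x + y ≡ x′ + y′ [mod d ]
mod-+ {d} {x} {x′} {y} {y′} p q = subst (d ∣_) (identity x x′ y y′) (∣m∣n⇒∣m+n p q)
  where
  identity : ∀ x x′ y y′ → x - x′ + (y - y′) ≡ x + y - (x′ + y′)
  identity = solve-∀

mod-* : ∀ {d} c x x′ → x ≡ x′ [mod d ] → c * x ≡ c * x′ [mod d ]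
mod-* {d} c x x′ p = subst (d ∣_) (identity c x x′) (∣n⇒∣m*n c p)
  where
  identity : ∀ c x x′ → c * (x - x′) ≡ c * x - c * x′
  identity = solve-∀

∣⇒≡mod0 : ∀ {d x} → d ∣ x → x ≡ 0ℤ [mod d ]
∣⇒≡mod0 {d} {x} = subst (d ∣_) (sym (ℤ.+-identityʳ x))

*-∣ : ∀ {c d x y} → c ∣ x → d ∣ y → c * d ∣ x * y
*-∣ {c} {d} {x} {y} c∣x d∣y = ∣-trans (*-monoʳ-∣ c d∣y) (*-monoˡ-∣ y c∣x)

^-∣-mono : ∀ i {m n} → m ℕ.≤ n → i ^ m ∣ i ^ n
^-∣-mono i {m} {n} m≤n = divides (i ^ (n ℕ.∸ m))
  (trans (cong (i ^_) (sym (ℕ.m∸n+n≡m m≤n))) (ℤ.^-distribˡ-+-* i (n ℕ.∸ m) m))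

^-∣ : ∀ {i j} n → i ∣ j → i ^ n ∣ j ^ n
^-∣ zero    i∣j = ∣-refl
^-∣ (suc n) i∣j = *-∣ i∣j (^-∣ n i∣j)

pos-^ : ∀ m n → + (m ℕ.^ n) ≡ (+ m) ^ n
pos-^ m zero    = refl
pos-^ m (suc n) = trans (ℤ.pos-* m (m ℕ.^ n)) (cong (+ m *_) (pos-^ m n))

sumTo-split : ∀ (f : ℕ → ℤ) m n →
  ∑[ i < m ℕ.+ n ] f (toℕ i) ≡ ∑[ i < m ] f (toℕ i) + ∑[ i < n ] f (m ℕ.+ toℕ i)
sumTo-split f zero    n = sym (ℤ.+-identityˡ _)
sumTo-split f (suc m) n = trans (cong (_+_ (f 0)) (sumTo-split (D f) m n))
  (sym (ℤ.+-assoc (f 0) _ _))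

∣-sumTo : ∀ {d} (f : ℕ → ℤ) n → (∀ i → d ∣ f i) → d ∣ ∑[ i < n ] f (toℕ i)
∣-sumTo f zero    d∣f = divides 0ℤ refl
∣-sumTo f (suc n) d∣f = ∣m∣n⇒∣m+n (d∣f 0) (∣-sumTo (D f) n (d∣f ∘ suc))

sumTo-mod : ∀ {d} (f g : ℕ → ℤ) n → (∀ i → f i ≡ g i [mod d ]) →
  ∑[ i < n ] f (toℕ i) ≡ ∑[ i < n ] g (toℕ i) [mod d ]
sumTo-mod f g zero    f≡g = divides 0ℤ refl
sumTo-mod f g (suc n) f≡g = mod-+ {x = f 0} {g 0} {∑[ i < n ] f (suc (toℕ i))} {∑[ i < n ] g (suc (toℕ i))}
  (f≡g 0) (sumTo-mod (D f) (D g) n (f≡g ∘ suc))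

-- The binomial transform Σₖ C(n,k) f k, as multiplication of the generating function by eᵗ.
transform : (ℕ → ℤ) → ℕ → ℤ
transform f = f ⋆ const 1ℤ

∣-transform : ∀ {d f} → (∀ k → d ∣ f k) → ∀ n → d ∣ transform f n
∣-transform d∣f zero    = ∣m⇒∣m*n 1ℤ (d∣f 0)
∣-transform d∣f (suc n) = ∣m∣n⇒∣m+n (∣-transform (d∣f ∘ suc) n) (∣-transform d∣f n)

shift : (ℕ → ℤ) → ℕ → ℕ → ℤ
shift f k j = f (k ℕ.+ j)

-- `transform f n` is the value at 0 of (1 + D)ⁿ applied to f, so this is (1 + D)^(m+n) = (1 + D)^m
-- (1 + D)^n.
transform-+ : ∀ f m n → transform f (m ℕ.+ n) ≡ transform (λ k → transform (shift f k) n) m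
transform-+ f zero    n = sym (ℤ.*-identityʳ _)
transform-+ f (suc m) n = cong₂ _+_ (transform-+ (D f) m n) (transform-+ f m n)

transform-mod : ∀ {d} f n N → (∀ k → d ∣ + (n C (N ℕ.+ k)) * f (N ℕ.+ k)) →
  transform f n ≡ ∑[ k < N ] (+ (n C toℕ k) * f (toℕ k)) [mod d ]
transform-mod {d} f n N d∣tail = subst (d ∣_) (sym difference) (∣-sumTo _ (suc n) d∣tail)
  where
  term : ℕ → ℤ
  term k = + (n C k) * f k
  cancel : ∀ x y → x + y - x ≡ y
  cancel = solve-∀
  -- Padding with the zero terms k > n allows a split at `N` whether or not `N` exceeds n.
  extend : ∀ M → ∑[ k < M ℕ.+ suc n ] term (toℕ k) ≡ ∑[ k < suc n ] term (toℕ k)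
  extend zero    = refl
  extend (suc M) = trans (sumTo-extend term (M ℕ.+ suc n)
      (cong (λ c → + c * f (M ℕ.+ suc n)) (k>n⇒nCk≡0 (ℕ.m≤n+m (suc n) M))))
    (extend M)
  difference : transform f n - ∑[ k < N ] term (toℕ k) ≡ ∑[ k < suc n ] term (N ℕ.+ toℕ k)
  difference = begin
    transform f n - S₀
      ≡⟨ cong (_- S₀) (⋆-binomial f (const 1ℤ) n) ⟩
    ∑[ k < suc n ] (term (toℕ k) * 1ℤ) - S₀
      ≡⟨ cong (_- S₀) (sum-cong-≗ {suc n} (λ k → ℤ.*-identityʳ (term (toℕ k)))) ⟩
    ∑[ k < suc n ] term (toℕ k) - S₀
      ≡⟨ cong (_- S₀) (trans (sym (extend N)) (sumTo-split term N (suc n))) ⟩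
    S₀ + ∑[ k < suc n ] term (N ℕ.+ toℕ k) - S₀
      ≡⟨ cancel S₀ _ ⟩
    ∑[ k < suc n ] term (N ℕ.+ toℕ k) ∎
    where S₀ = ∑[ k < N ] term (toℕ k)

-- Over ℤ this needs no bound on k: at k = n the factor n - k vanishes, and beyond it both binomial
-- coefficients do.
C-step : ∀ n k → + suc k * + (n C suc k) ≡ (+ n - + k) * + (n C k)
C-step zero    zero    = refl
C-step zero    (suc k) = begin
  + suc (suc k) * + (0 C suc (suc k))   ≡⟨ cong (λ c → + suc (suc k) * + c) (k>n⇒nCk≡0 {0} {suc (suc k)} (ℕ.s≤s ℕ.z≤n)) ⟩
  + suc (suc k) * 0ℤ                    ≡⟨ ℤ.*-zeroʳ (+ suc (suc k)) ⟩
  0ℤ                                    ≡⟨ ℤ.*-zeroʳ (0ℤ - + suc k) ⟨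
  (0ℤ - + suc k) * 0ℤ                   ≡⟨ cong (λ c → (0ℤ - + suc k) * + c) (k>n⇒nCk≡0 {0} {suc k} (ℕ.s≤s ℕ.z≤n)) ⟨
  (0ℤ - + suc k) * + (0 C suc k) ∎
C-step (suc n) zero    = begin
  1ℤ * + (suc n C 1)                    ≡⟨ cong (λ c → 1ℤ * + c) (nC1≡n (suc n)) ⟩
  1ℤ * + suc n                          ≡⟨ identity (+ suc n) ⟩
  (+ suc n - 0ℤ) * 1ℤ                   ≡⟨ cong (λ c → (+ suc n - 0ℤ) * + c) (nC0≡1 (suc n)) ⟨
  (+ suc n - 0ℤ) * + (suc n C 0) ∎
  where
  identity : ∀ x → 1ℤ * x ≡ (x - 0ℤ) * 1ℤ
  identity = solve-∀
C-step (suc n) (suc k) = begin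
  + suc (suc k) * + (suc n C suc (suc k))
    ≡⟨ cong (λ c → + suc (suc k) * + c) (nCk+nC[k+1]≡[n+1]C[k+1] n (suc k)) ⟨
  + suc (suc k) * (y + z)
    ≡⟨ ℤ.*-distribˡ-+ (+ suc (suc k)) y z ⟩
  + suc (suc k) * y + + suc (suc k) * z
    ≡⟨ cong (_+_ (+ suc (suc k) * y)) (C-step n (suc k)) ⟩
  + suc (suc k) * y + (+ n - + suc k) * y
    ≡⟨ regroup (+ n) (+ k) y ⟩
  + suc k * y + (+ n - + k) * y
    ≡⟨ cong (_+ (+ n - + k) * y) (C-step n k) ⟩
  (+ n - + k) * x + (+ n - + k) * y
    ≡⟨ collect (+ n) (+ k) x y ⟩
  (+ suc n - + suc k) * (x + y)
    ≡⟨ cong (λ c → (+ suc n - + suc k) * + c) (nCk+nC[k+1]≡[n+1]C[k+1] n k) ⟩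
  (+ suc n - + suc k) * + (suc n C suc k) ∎
  where
  x = + (n C k)
  y = + (n C suc k)
  z = + (n C suc (suc k))
  regroup : ∀ n k y → (1ℤ + (1ℤ + k)) * y + (n - (1ℤ + k)) * y ≡ (1ℤ + k) * y + (n - k) * y
  regroup = solve-∀
  collect : ∀ n k x y → (n - k) * x + (n - k) * y ≡ ((1ℤ + n) - (1ℤ + k)) * (x + y)
  collect = solve-∀

-- Hence 2^m ∣ X implies 2^m ∣ j · C(X,j), which controls the binomial coefficients with large j.
C-absorb : ∀ n k → suc k ℕ.* (suc n C suc k) ≡ suc n ℕ.* (n C k)
C-absorb n k = ℤ.+-injective (begin
  + (suc k ℕ.* (suc n C suc k))              ≡⟨ ℤ.pos-* (suc k) _ ⟩
  + suc k * + (suc n C suc k)                ≡⟨ cong (λ c → + suc k * + c) (nCk+nC[k+1]≡[n+1]C[k+1] n k) ⟨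
  + suc k * (x + + (n C suc k))              ≡⟨ ℤ.*-distribˡ-+ (+ suc k) x _ ⟩
  + suc k * x + + suc k * + (n C suc k)      ≡⟨ cong (_+_ (+ suc k * x)) (C-step n k) ⟩
  + suc k * x + (+ n - + k) * x              ≡⟨ collect (+ n) (+ k) x ⟩
  + suc n * x                                ≡⟨ ℤ.pos-* (suc n) _ ⟨
  + (suc n ℕ.* (n C k)) ∎)
  where
  x = + (n C k)
  collect : ∀ n k x → (1ℤ + k) * x + (n - k) * x ≡ (1ℤ + n) * x
  collect = solve-∀

even-or-odd : ∀ n → (∃[ h ] n ≡ 2 ℕ.* h) ⊎ (∃[ h ] n ≡ suc (2 ℕ.* h))
even-or-odd zero = inj₁ (0 , refl)
even-or-odd (suc n) with even-or-odd n
... | inj₁ (h , n≡2h)   = inj₂ (h , cong suc n≡2h)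
... | inj₂ (h , n≡1+2h) = inj₁ (suc h , trans (cong suc n≡1+2h) (sym (ℕ.*-suc 2 h)))

-- Induction on m: (1 + 2h)c and 2hc are even, so c is even, and a factor 2 cancels on both sides.
2^∣odd*c⇒2^∣c : ∀ h m c → 2 ℕ.^ m ℕ.∣ suc (2 ℕ.* h) ℕ.* c → 2 ℕ.^ m ℕ.∣ c
2^∣odd*c⇒2^∣c h zero    c _ = ℕ.1∣ c
2^∣odd*c⇒2^∣c h (suc m) c 2^∣
  with ℕ.∣m+n∣m⇒∣n (subst (2 ℕ.∣_) (ℕ.+-comm c _) (ℕ.∣-trans (ℕ.m∣m*n (2 ℕ.^ m)) 2^∣))
        (subst (2 ℕ.∣_) (sym (ℕ.*-assoc 2 h c)) (ℕ.m∣m*n (h ℕ.* c)))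
... | ℕ.divides c′ refl = subst (2 ℕ.* 2 ℕ.^ m ℕ.∣_) (ℕ.*-comm 2 c′)
  (ℕ.*-monoʳ-∣ 2 (2^∣odd*c⇒2^∣c h m c′ (ℕ.*-cancelˡ-∣ 2
    (subst (2 ℕ.^ suc m ℕ.∣_) (trans (sym (ℕ.*-assoc (suc (2 ℕ.* h)) c′ 2)) (ℕ.*-comm (suc (2 ℕ.* h) ℕ.* c′) 2)) 2^∣))))

2-adic : ∀ j .{{_ : ℕ.NonZero j}} → ∃[ v ] (2 ℕ.^ v ℕ.∣ j ×
  (∀ m c → 2 ℕ.^ m ℕ.∣ j ℕ.* c → 2 ℕ.^ m ℕ.∣ 2 ℕ.^ v ℕ.* c))
2-adic j {{j≢0}} = <-rec P step j {{j≢0}}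
  where
  P : ℕ → Set
  P j = .{{_ : ℕ.NonZero j}} → ∃[ v ] (2 ℕ.^ v ℕ.∣ j ×
    (∀ m c → 2 ℕ.^ m ℕ.∣ j ℕ.* c → 2 ℕ.^ m ℕ.∣ 2 ℕ.^ v ℕ.* c))
  step : ∀ j → (∀ {i} → i ℕ.< j → P i) → P j
  step j rec with even-or-odd j
  ... | inj₂ (h , refl) = 0 , ℕ.1∣ j , λ m c 2^∣ →
    subst (2 ℕ.^ m ℕ.∣_) (sym (ℕ.*-identityˡ c)) (2^∣odd*c⇒2^∣c h m c 2^∣)
  ... | inj₁ (suc h , refl) with rec {suc h} (ℕ.m<m+n (suc h) (ℕ.s≤s ℕ.z≤n))
  ...   | v , 2^v∣h , cancel = suc v , ℕ.*-monoʳ-∣ 2 2^v∣h , lift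
    where
    lift : ∀ m c → 2 ℕ.^ m ℕ.∣ (2 ℕ.* suc h) ℕ.* c → 2 ℕ.^ m ℕ.∣ (2 ℕ.* 2 ℕ.^ v) ℕ.* c
    lift zero    c _   = ℕ.1∣ _
    lift (suc m) c 2^∣ = subst (2 ℕ.^ suc m ℕ.∣_) (sym (ℕ.*-assoc 2 (2 ℕ.^ v) c))
      (ℕ.*-monoʳ-∣ 2 (cancel m c (ℕ.*-cancelˡ-∣ 2 (subst (2 ℕ.^ suc m ℕ.∣_) (ℕ.*-assoc 2 (suc h) c) 2^∣))))

-- For v ≥ 3 the size bound 2^v ≥ v + 5 suffices, with equality at v = 3. For v = 2 it does not, and
-- j = 6 is excluded by 4 ∤ 6.
2^∣⇒small : ∀ v {j} → 6 ℕ.≤ j → 2 ℕ.^ v ℕ.∣ j → v ℕ.+ 5 ℕ.≤ j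
2^∣⇒small 0 6≤j _ = ℕ.≤-trans (ℕ.n≤1+n 5) 6≤j
2^∣⇒small 1 6≤j _ = 6≤j
2^∣⇒small 2 {j} 6≤j 4∣j = ℕ.≤∧≢⇒< 6≤j λ { refl → ℕ.>⇒∤ {2} {4} (ℕ.s≤s (ℕ.s≤s (ℕ.s≤s ℕ.z≤n))) (ℕ.∣m+n∣m⇒∣n {4} {4} {2} 4∣j ℕ.∣-refl) }
2^∣⇒small (suc (suc (suc v))) {j} 6≤j 2^v∣j = ℕ.≤-trans (bound v)
  (ℕ.∣⇒≤ {{ℕ.>-nonZero (ℕ.≤-trans (ℕ.s≤s ℕ.z≤n) 6≤j)}} 2^v∣j)
  where
  bound : ∀ v → 3 ℕ.+ v ℕ.+ 5 ℕ.≤ 2 ℕ.^ (3 ℕ.+ v)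
  bound zero    = ℕ.≤-refl
  bound (suc v) = ℕ.+-mono-≤ {1} (ℕ.m^n>0 2 (3 ℕ.+ v)) (ℕ.≤-trans (bound v) (ℕ.m≤m+n _ 0))

-- The terms of the expansion of E a (X + b)

e : ℤ → ℕ → ℤ
e a = scale a 1-tanh

-- The power a^(5+n) contributes 5 + n factors 2, and the coefficient of tanh four more.
2^∣e : ∀ {a} → + 2 ∣ a → ∀ n p → p ℕ.≤ 9 ℕ.+ n → (+ 2) ^ p ∣ e a (5 ℕ.+ n)
2^∣e {a} 2∣a n p p≤9+n = ∣-trans (^-∣-mono (+ 2) p≤9+n)
  (subst (_∣ e a (5 ℕ.+ n)) (trans (sym (ℤ.^-distribˡ-+-* (+ 2) (5 ℕ.+ n) 4)) (cong (λ k → (+ 2) ^ (5 ℕ.+ k)) (ℕ.+-comm n 4)))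
    (*-∣ {(+ 2) ^ (5 ℕ.+ n)} {+ 16} (^-∣ (5 ℕ.+ n) 2∣a)
      (subst (+ 16 ∣_) (sym (ℤ.+-identityˡ (-1ℤ * tanh (5 ℕ.+ n)))) (∣n⇒∣m*n -1ℤ (16∣tanh n)))))

e-suc : ∀ a {t} k → tanh (suc k) ≡ t → e a (suc k) ≡ a ^ suc k * (0ℤ + -1ℤ * t)
e-suc a k = cong (λ t → a ^ suc k * (0ℤ + -1ℤ * t))

e-even : ∀ a h → e a (2 ℕ.* suc h) ≡ 0ℤ
e-even a h = trans (e-suc a (h ℕ.+ suc (h ℕ.+ 0)) (tanh-even (suc h))) (ℤ.*-zeroʳ (a ^ (2 ℕ.* suc h)))

-- The value c at 7 is a parameter: 272 a⁷ is needed modulo 2^12, but vanishes modulo 2^11.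
e-truncated : ℤ → ℤ → ℕ → ℤ
e-truncated a c 0 = 1ℤ
e-truncated a c 1 = - a
e-truncated a c 2 = 0ℤ
e-truncated a c 3 = + 2 * a ^ 3
e-truncated a c 4 = 0ℤ
e-truncated a c 5 = - (+ 16 * a ^ 5)
e-truncated a c 6 = 0ℤ
e-truncated a c 7 = c
e-truncated a c (suc (suc (suc (suc (suc (suc (suc (suc n)))))))) = 0ℤ

e≡e-truncated : ∀ {a c d} → + 2 ∣ a → d ∣ (+ 2) ^ 12 → e a 7 ≡ c [mod d ] →
  ∀ k → e a k ≡ e-truncated a c k [mod d ]
e≡e-truncated {a} _ _ _ 0 = ≡⇒≡mod (cong (λ t → 1ℤ * (1ℤ + -1ℤ * t)) tanh-0)
e≡e-truncated {a} _ _ _ 1 = ≡⇒≡mod (trans (e-suc a 0 tanh-1) (identity a))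
  where
  identity : ∀ a → a * 1ℤ * -1ℤ ≡ - a
  identity = solve-∀
e≡e-truncated {a} _ _ _ 2 = ≡⇒≡mod (e-even a 0)
e≡e-truncated {a} _ _ _ 3 = ≡⇒≡mod (trans (e-suc a 2 tanh-3) (ℤ.*-comm (a ^ 3) (+ 2)))
e≡e-truncated {a} _ _ _ 4 = ≡⇒≡mod (e-even a 1)
e≡e-truncated {a} _ _ _ 5 = ≡⇒≡mod (trans (e-suc a 4 tanh-5) (identity (a ^ 5)))
  where
  identity : ∀ x → x * - + 16 ≡ - (+ 16 * x)
  identity = solve-∀
e≡e-truncated {a} _ _ _ 6 = ≡⇒≡mod (e-even a 2)
e≡e-truncated _ _ e₇ 7 = e₇
e≡e-truncated {a} 2∣a d∣ _ (suc (suc (suc (suc (suc (suc (suc (suc n)))))))) =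
  ∣⇒≡mod0 (∣-trans d∣ (2^∣e 2∣a (3 ℕ.+ n) 12 (ℕ.m≤m+n 12 n)))

transform-truncated : ∀ {a c d} → + 2 ∣ a → d ∣ (+ 2) ^ 12 → e a 7 ≡ c [mod d ] →
  ∀ k n N → (∀ i → e-truncated a c (k ℕ.+ (N ℕ.+ i)) ≡ 0ℤ) →
  transform (shift (e a) k) n ≡ ∑[ i < N ] (+ (n C toℕ i) * e-truncated a c (k ℕ.+ toℕ i)) [mod d ]
transform-truncated {a} {c} {d} 2∣a d∣ e₇ k n N vanish =
  mod-trans (transform (shift (e a) k) n) (∑[ i < N ] (+ (n C toℕ i) * e a (k ℕ.+ toℕ i))) _
    (transform-mod (shift (e a) k) n N λ i → ∣n⇒∣m*n (+ (n C (N ℕ.+ i))) (tail i))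
    (sumTo-mod (λ i → + (n C i) * e a (k ℕ.+ i)) (λ i → + (n C i) * e-truncated a c (k ℕ.+ i)) N
      λ i → mod-* (+ (n C i)) (e a (k ℕ.+ i)) (e-truncated a c (k ℕ.+ i)) (approx (k ℕ.+ i)))
  where
  approx = e≡e-truncated 2∣a d∣ e₇
  tail : ∀ i → d ∣ e a (k ℕ.+ (N ℕ.+ i))
  tail i = subst (d ∣_) (trans (cong (λ y → e a (k ℕ.+ (N ℕ.+ i)) - y) (vanish i)) (ℤ.+-identityʳ _))
    (approx (k ℕ.+ (N ℕ.+ i)))

-- With v the valuation of j, absorption gives 2^m ∣ 2^v C(X,j), so the transform must supply
-- 2^(v+10). Each `e a i` with i ≥ 5 is divisible by 2^(i+4). For odd j this suffices as j ≥ 6; for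
-- even j the sum effectively starts at i = j + 1, and v + 5 ≤ j is enough.
2^∣C*transform : ∀ {a} → + 2 ∣ a → ∀ m n b j → 6 ℕ.≤ suc j → 2 ℕ.^ m ℕ.∣ suc n →
  (+ 2) ^ (m ℕ.+ 10) ∣ + (suc n C suc j) * transform (shift (e a) (suc j)) b
2^∣C*transform {a} 2∣a m n b j 6≤j 2^m∣n with 2-adic (suc j)
... | v , 2^v∣j , cancel = regroup (∣-transform {f = shift (e a) (suc j)} (2^[v+10]∣e v 2^v∣j) b)
  where
  c = suc n C suc j
  2^m∣2^v*c : (+ 2) ^ m ∣ (+ 2) ^ v * + c
  2^m∣2^v*c = subst₂ _∣_ (pos-^ 2 m) (trans (ℤ.pos-* (2 ℕ.^ v) c) (cong (_* + c) (pos-^ 2 v)))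
    (∣ᵤ⇒∣ {+ (2 ℕ.^ m)} {+ (2 ℕ.^ v ℕ.* c)} (cancel m c (subst (2 ℕ.^ m ℕ.∣_) (sym (C-absorb n j)) (ℕ.∣m⇒∣m*n (n C j) 2^m∣n))))
  regroup : ∀ {x} → (+ 2) ^ (v ℕ.+ 10) ∣ x → (+ 2) ^ (m ℕ.+ 10) ∣ + c * x
  regroup (divides q refl) = subst₂ _∣_ (sym (ℤ.^-distribˡ-+-* (+ 2) m 10))
    (trans (shuffle ((+ 2) ^ v) (+ c) q ((+ 2) ^ 10)) (cong (λ y → + c * (q * y)) (sym (ℤ.^-distribˡ-+-* (+ 2) v 10))))
    (*-∣ 2^m∣2^v*c (∣n⇒∣m*n q (∣-refl {(+ 2) ^ 10})))
    where
    shuffle : ∀ p c q r → (p * c) * (q * r) ≡ c * (q * (p * r))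
    shuffle = solve-∀
  e-bound : ∀ k p → 5 ℕ.≤ k → p ℕ.≤ k ℕ.+ 4 → (+ 2) ^ p ∣ e a k
  e-bound k p 5≤k p≤k+4 = subst (λ k → (+ 2) ^ p ∣ e a k) (ℕ.m+[n∸m]≡n 5≤k)
    (2^∣e 2∣a (k ℕ.∸ 5) p (ℕ.≤-trans p≤k+4 (ℕ.≤-reflexive
      (trans (ℕ.+-comm k 4) (cong (4 ℕ.+_) (sym (ℕ.m+[n∸m]≡n 5≤k)))))))
  5≤j+ : ∀ i → 5 ℕ.≤ suc j ℕ.+ i
  5≤j+ i = ℕ.≤-trans (ℕ.n≤1+n 5) (ℕ.≤-trans 6≤j (ℕ.m≤m+n (suc j) i))
  2^[v+10]∣e : ∀ v → 2 ℕ.^ v ℕ.∣ suc j → ∀ i → (+ 2) ^ (v ℕ.+ 10) ∣ e a (suc j ℕ.+ i)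
  2^[v+10]∣e zero _ i = e-bound (suc j ℕ.+ i) 10 (5≤j+ i)
    (ℕ.+-monoˡ-≤ 4 (ℕ.≤-trans 6≤j (ℕ.m≤m+n (suc j) i)))
  -- The size bound could fall one factor 2 short for the leading term, as at j = 6 and j = 8; but j
  -- is even, so the term is zero.
  2^[v+10]∣e (suc v) 2^v∣j zero with ℕ.∣-trans (ℕ.m∣m*n (2 ℕ.^ v)) 2^v∣j
  ... | ℕ.divides (suc h) j≡h*2 = subst (λ x → (+ 2) ^ (suc v ℕ.+ 10) ∣ x)
    (sym (trans (cong (e a) (trans (ℕ.+-identityʳ (suc j)) (trans j≡h*2 (ℕ.*-comm (suc h) 2)))) (e-even a h)))
    (divides 0ℤ refl)
  2^[v+10]∣e (suc v) 2^v∣j (suc i) = e-bound (suc j ℕ.+ suc i) (suc v ℕ.+ 10) (5≤j+ (suc i))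
    (ℕ.≤-trans (ℕ.≤-reflexive (sym (ℕ.+-assoc (suc v) 5 5)))
      (ℕ.≤-trans (ℕ.+-monoˡ-≤ 5 (2^∣⇒small (suc v) 6≤j 2^v∣j))
        (ℕ.≤-trans (ℕ.≤-reflexive (sym (ℕ.+-assoc (suc j) 1 4)))
          (ℕ.+-monoˡ-≤ 4 (ℕ.+-monoʳ-≤ (suc j) (ℕ.s≤s (ℕ.z≤n {i})))))))

-- Binomial coefficients as falling factorials

C₁ : ∀ n → + (n C 1) ≡ + n
C₁ n = cong +_ (nC1≡n n)

C₂ : ∀ n → + 2 * + (n C 2) ≡ + n * (+ n - 1ℤ)
C₂ n = trans (C-step n 1) (trans (cong ((+ n - 1ℤ) *_) (C₁ n)) (ℤ.*-comm (+ n - 1ℤ) (+ n)))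

C-falling : ∀ n k r {p} → r * + (n C k) ≡ p → (+ suc k * r) * + (n C suc k) ≡ p * (+ n - + k)
C-falling n k r {p} rC≡p = begin
  (+ suc k * r) * + (n C suc k)     ≡⟨ shuffle (+ suc k) r (+ (n C suc k)) ⟩
  r * (+ suc k * + (n C suc k))     ≡⟨ cong (r *_) (C-step n k) ⟩
  r * ((+ n - + k) * + (n C k))     ≡⟨ ℤ.*-assoc r (+ n - + k) (+ (n C k)) ⟨
  (r * (+ n - + k)) * + (n C k)     ≡⟨ shuffle′ r (+ n - + k) (+ (n C k)) ⟩
  r * + (n C k) * (+ n - + k)       ≡⟨ cong (_* (+ n - + k)) rC≡p ⟩
  p * (+ n - + k) ∎
  where
  shuffle : ∀ s r c → (s * r) * c ≡ r * (s * c)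
  shuffle = solve-∀
  shuffle′ : ∀ r s c → (r * s) * c ≡ r * c * s
  shuffle′ = solve-∀

C₃ : ∀ n → + 6 * + (n C 3) ≡ + n * (+ n - 1ℤ) * (+ n - + 2)
C₃ n = C-falling n 2 (+ 2) (C₂ n)

C₄ : ∀ n → + 24 * + (n C 4) ≡ + n * (+ n - 1ℤ) * (+ n - + 2) * (+ n - + 3)
C₄ n = C-falling n 3 (+ 6) (C₃ n)

C₅ : ∀ n → + 120 * + (n C 5) ≡ + n * (+ n - 1ℤ) * (+ n - + 2) * (+ n - + 3) * (+ n - + 4)
C₅ n = C-falling n 4 (+ 24) (C₄ n)

C₀* : ∀ n x → + (n C 0) * x ≡ x
C₀* n x = trans (cong (λ c → + c * x) (nC0≡1 n)) (ℤ.*-identityˡ x)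

-- pⱼ is 45 C(X,j) Gⱼ / 3X, simplified modulo 2^10; the factor 45 clears the odd parts of the
-- denominators coming from the binomial coefficients of X and b.
p₁ p₂ p₃ p₄ p₅ : (a a³ a⁵ a⁷ b X : ℤ) → ℤ
p₁ a a³ a⁵ a⁷ b X = + 15 * (- a + a³ * (b * (b - 1ℤ))) - + 10 * (a⁵ * (b * (b - 1ℤ) * (b - + 2) * (b - + 3)))
p₂ a a³ a⁵ a⁷ b X = + 15 * ((X - 1ℤ) * a³ * b) + + 20 * (a⁵ * (b * (b - 1ℤ) * (b - + 2)))
p₃ a a³ a⁵ a⁷ b X = (+ 10 - + 15 * X) * a³ - + 40 * (a⁵ * (b * (b - 1ℤ)))
p₄ a a³ a⁵ a⁷ b X = + 60 * (a⁵ * b) - + 170 * (a⁷ * (b * (b - 1ℤ) * (b - + 2)))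
p₅ a a³ a⁵ a⁷ b X = - (+ 16 * a⁵)

-- Applied with y = C(X,j) and 45 = u · v: `u` clears the odd part of j!, and `v` is what is left
-- for the factorials in `G`. Knowing `v * G` modulo `d` suffices because the powers of 2 in `c`
-- make up the rest of the precision.
scaled-product : ∀ u v y G r c g p d → u * y ≡ r * c → v * G ≡ g [mod d ] → (+ 2) ^ 13 ∣ c * d →
  c * g ≡ + 24 * p [mod (+ 2) ^ 13 ] → (u * v) * (y * G) ≡ r * (+ 24 * p) [mod r * (+ 2) ^ 13 ]
scaled-product u v y G r c g p d uC≡rc vG≡g 2^∣cd cg≡24p =
  subst (_≡ r * (+ 24 * p) [mod r * (+ 2) ^ 13 ]) (sym product)
    (subst (r * (+ 2) ^ 13 ∣_) (distribute r (c * (v * G)) (+ 24 * p)) (*-monoʳ-∣ r inner))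
  where
  shuffle : ∀ u v y G → (u * v) * (y * G) ≡ (u * y) * (v * G)
  shuffle = solve-∀
  distribute : ∀ r x z → r * (x - z) ≡ r * x - r * z
  distribute = solve-∀
  product : (u * v) * (y * G) ≡ r * (c * (v * G))
  product = trans (shuffle u v y G) (trans (cong (_* (v * G)) uC≡rc) (ℤ.*-assoc r c (v * G)))
  inner : c * (v * G) ≡ + 24 * p [mod (+ 2) ^ 13 ]
  inner = mod-trans (c * (v * G)) (c * g) (+ 24 * p)
    (subst ((+ 2) ^ 13 ∣_) (distribute c (v * G) g) (∣-trans 2^∣cd (*-monoʳ-∣ c vG≡g))) cg≡24p

mod-scale : ∀ {c d} k x y → c ∣ k → x ≡ y [mod d ] → k * x ≡ k * y [mod c * d ]
mod-scale {c} {d} k x y c∣k x≡y = subst (c * d ∣_) (distribute k x y) (*-∣ {c} {d} {k} c∣k x≡y)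
  where
  distribute : ∀ r x y → r * (x - y) ≡ r * x - r * y
  distribute = solve-∀

-- Used with `s` the power of 2 in j!, which is extracted from the even factors of the falling
-- factorial of X and cancelled exactly in ℤ.
cancel-factor : ∀ s u y {p q} .{{_ : ℕ.NonZero ∣ s ∣}} → (s * u) * y ≡ p → p ≡ s * q → u * y ≡ q
cancel-factor s u y {p} {q} eq p≡sq = ℤ.*-cancelˡ-≡ s (u * y) q
  (trans (sym (ℤ.*-assoc s u y)) (trans eq p≡sq))

-- The parameter is r = X/8 with r even, rather than X/16, to keep the literals below small.
module Terms (a r : ℤ) (2∣a : + 2 ∣ a) (2∣r : + 2 ∣ r) (X : ℕ) (X≡8r : + X ≡ + 8 * r) (b : ℕ) where

  G : ℕ → ℤ
  G k = transform (shift (e a) k) b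

  a³ a⁵ a⁷ : ℤ
  a³ = a ^ 3
  a⁵ = a ^ 5
  a⁷ = a ^ 7

  32∣a⁵ : + 32 ∣ a⁵
  32∣a⁵ = ^-∣ 5 2∣a

  128∣a⁷ : + 128 ∣ a⁷
  128∣a⁷ = ^-∣ 7 2∣a

  8∣a³ : + 8 ∣ a³
  8∣a³ = ^-∣ 3 2∣a

  e₇≡0 : e a 7 ≡ 0ℤ [mod (+ 2) ^ 11 ]
  e₇≡0 = ∣⇒≡mod0 (2^∣e 2∣a 2 11 ℕ.≤-refl)

  vanish : ∀ i → e-truncated a 0ℤ (6 ℕ.+ i) ≡ 0ℤ
  vanish 0             = refl
  vanish 1             = refl
  vanish (suc (suc i)) = refl

  2^11∣2^12 : (+ 2) ^ 11 ∣ (+ 2) ^ 12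
  2^11∣2^12 = ^-∣-mono (+ 2) (ℕ.n≤1+n 11)

  e₇ : e a 7 ≡ + 16 * (+ 17 * a⁷)
  e₇ = trans (e-suc a 6 tanh-7) (identity a⁷)
    where
    identity : ∀ x → x * + 272 ≡ + 16 * (+ 17 * x)
    identity = solve-∀

  X-k : ∀ k → + X - k ≡ + 8 * r - k
  X-k k = cong (_- k) X≡8r

  term₁ : + 45 * (+ (X C 1) * G 1) ≡ r * (+ 24 * p₁ a a³ a⁵ a⁷ (+ b) (+ 8 * r)) [mod r * (+ 2) ^ 13 ]
  term₁ = scaled-product 1ℤ (+ 45) (+ (X C 1)) (G 1) r (+ 8) (+ 3 * p) p ((+ 2) ^ 11)
    (trans (ℤ.*-identityˡ _) (trans (C₁ X) (trans X≡8r (ℤ.*-comm (+ 8) r))))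
    (mod-trans (+ 45 * G 1) (+ 45 * S) (+ 3 * p)
      (mod-* (+ 45) (G 1) S (transform-truncated {c = 0ℤ} 2∣a 2^11∣2^12 e₇≡0 1 b 5 vanish))
      (≡⇒≡mod (trans (expand (+ (b C 0) * - a) a³ a⁵ (+ (b C 1)) (+ (b C 2)) (+ (b C 3)) (+ (b C 4)))
        (cong₂ (λ x y → + 3 * (+ 15 * x - + 10 * (a⁵ * y)))
          (cong₂ (λ z c → z + a³ * c) (C₀* b (- a)) (C₂ b)) (C₄ b)))))
    (divides (+ 2) refl)
    (≡⇒≡mod (sym (ℤ.*-assoc (+ 8) (+ 3) p)))
    where
    p = p₁ a a³ a⁵ a⁷ (+ b) (+ 8 * r)
    S = ∑[ i < 5 ] (+ (b C toℕ i) * e-truncated a 0ℤ (1 ℕ.+ toℕ i))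
    expand : ∀ z a³ a⁵ b₁ b₂ b₃ b₄ →
      + 45 * (z + (b₁ * 0ℤ + (b₂ * (+ 2 * a³) + (b₃ * 0ℤ + (b₄ * - (+ 16 * a⁵) + 0ℤ)))))
        ≡ + 3 * (+ 15 * (z + a³ * (+ 2 * b₂)) - + 10 * (a⁵ * (+ 24 * b₄)))
    expand = solve-∀

  term₂ : + 45 * (+ (X C 2) * G 2) ≡ r * (+ 24 * p₂ a a³ a⁵ a⁷ (+ b) (+ 8 * r)) [mod r * (+ 2) ^ 13 ]
  term₂ = scaled-product 1ℤ (+ 45) (+ (X C 2)) (G 2) r (+ 4 * (+ 8 * r - 1ℤ)) (+ 6 * h) p ((+ 2) ^ 11)
    (cancel-factor (+ 2) 1ℤ (+ (X C 2)) (C₂ X) (trans (cong₂ _*_ X≡8r (X-k 1ℤ)) (halve r (+ 8 * r - 1ℤ))))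
    (mod-trans (+ 45 * G 2) (+ 45 * S) (+ 6 * h)
      (mod-* (+ 45) (G 2) S (transform-truncated {c = 0ℤ} 2∣a 2^11∣2^12 e₇≡0 2 b 4 vanish))
      (≡⇒≡mod (trans (expand a³ a⁵ (+ (b C 0)) (+ (b C 1)) (+ (b C 2)) (+ (b C 3)))
        (cong₂ (λ x y → + 6 * (+ 15 * (a³ * x) - + 20 * (a⁵ * y))) (C₁ b) (C₃ b)))))
    (*-∣ {+ 4} {(+ 2) ^ 11} (∣m⇒∣m*n (+ 8 * r - 1ℤ) (∣-refl {+ 4})) (∣-refl {(+ 2) ^ 11}))
    (subst (_≡ + 24 * p [mod (+ 2) ^ 13 ]) (collect (+ 8 * r - 1ℤ) h)
      (mod-scale {+ 8} {(+ 2) ^ 10} (+ 24) ((+ 8 * r - 1ℤ) * h) p (divides (+ 3) refl)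
        -- Since 32 ∣ a⁵, its coefficient matters only modulo 32, where -20(8r - 1) equals 20.
        (subst ((+ 2) ^ 10 ∣_) (sym (difference r a³ a⁵ (+ b) y))
          (*-∣ {+ 32} {+ 32} 32∣a⁵ (∣m⇒∣m*n (- (+ 5 * r * y)) (∣-refl {+ 32}))))))
    where
    p = p₂ a a³ a⁵ a⁷ (+ b) (+ 8 * r)
    y = + b * (+ b - 1ℤ) * (+ b - + 2)
    h = + 15 * (a³ * + b) - + 20 * (a⁵ * y)
    S = ∑[ i < 4 ] (+ (b C toℕ i) * e-truncated a 0ℤ (2 ℕ.+ toℕ i))
    halve : ∀ r y → + 8 * r * y ≡ + 2 * (r * (+ 4 * y))
    halve = solve-∀
    expand : ∀ a³ a⁵ b₀ b₁ b₂ b₃ →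
      + 45 * (b₀ * 0ℤ + (b₁ * (+ 2 * a³) + (b₂ * 0ℤ + (b₃ * - (+ 16 * a⁵) + 0ℤ))))
        ≡ + 6 * (+ 15 * (a³ * b₁) - + 20 * (a⁵ * (+ 6 * b₃)))
    expand = solve-∀
    collect : ∀ y h → + 24 * (y * h) ≡ + 4 * y * (+ 6 * h)
    collect = solve-∀
    difference : ∀ r a³ a⁵ b y →
      (+ 8 * r - 1ℤ) * (+ 15 * (a³ * b) - + 20 * (a⁵ * y))
        - (+ 15 * ((+ 8 * r - 1ℤ) * a³ * b) + + 20 * (a⁵ * y))
        ≡ a⁵ * (+ 32 * (- (+ 5 * r * y)))
    difference = solve-∀

  term₃ : + 45 * (+ (X C 3) * G 3) ≡ r * (+ 24 * p₃ a a³ a⁵ a⁷ (+ b) (+ 8 * r)) [mod r * (+ 2) ^ 13 ]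
  term₃ = scaled-product (+ 3) (+ 15) (+ (X C 3)) (G 3) r (+ 8 * c) (+ 3 * h) p ((+ 2) ^ 11)
    (cancel-factor (+ 2) (+ 3) (+ (X C 3)) (C₃ X) (trans
      (cong₂ _*_ (cong₂ _*_ X≡8r (X-k 1ℤ)) (trans (X-k (+ 2)) (8r-2 r)))
      (halve r (+ 8 * r - 1ℤ) (+ 4 * r - 1ℤ))))
    (mod-trans (+ 15 * G 3) (+ 15 * S) (+ 3 * h)
      (mod-* (+ 15) (G 3) S (transform-truncated {c = 0ℤ} 2∣a 2^11∣2^12 e₇≡0 3 b 3 vanish))
      (≡⇒≡mod (trans (expand (+ (b C 0) * (+ 2 * a³)) a⁵ (+ (b C 1)) (+ (b C 2)))
        (cong₂ (λ x y → + 3 * (+ 5 * x - + 40 * (a⁵ * y))) (C₀* b (+ 2 * a³)) (C₂ b)))))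
    (∣-trans (divides (+ 2) refl) (*-∣ {+ 8} {(+ 2) ^ 11} (∣m⇒∣m*n c (∣-refl {+ 8})) (∣-refl {(+ 2) ^ 11})))
    (subst (_≡ + 24 * p [mod (+ 2) ^ 13 ]) (collect c h)
      (mod-scale {+ 8} {(+ 2) ^ 10} (+ 24) (c * h) p (divides (+ 3) refl)
        -- The coefficient of a³ matters modulo 128 and that of a⁵ modulo 32. The discarded parts
        -- 320r² and 160r(3 - 8r) vanish there because r is even, that is, 16 ∣ X.
        (subst ((+ 2) ^ 10 ∣_) (sym (difference r a³ a⁵ y))
          (∣m∣n⇒∣m+n
            (*-∣ {+ 8} {+ 128} 8∣a³ (*-∣ {+ 64} {+ 2} (∣-refl {+ 64}) (∣m⇒∣m*n (+ 5 * r) 2∣r)))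
            (*-∣ {+ 32} {+ 32} 32∣a⁵ (*-∣ {+ 16} {+ 2} (∣-refl {+ 16}) (∣m⇒∣m*n (+ 10 * (+ 3 - + 8 * r) * y) 2∣r)))))))
    where
    p = p₃ a a³ a⁵ a⁷ (+ b) (+ 8 * r)
    c = (+ 8 * r - 1ℤ) * (+ 4 * r - 1ℤ)
    y = + b * (+ b - 1ℤ)
    h = + 5 * (+ 2 * a³) - + 40 * (a⁵ * y)
    S = ∑[ i < 3 ] (+ (b C toℕ i) * e-truncated a 0ℤ (3 ℕ.+ toℕ i))
    8r-2 : ∀ r → + 8 * r - + 2 ≡ + 2 * (+ 4 * r - 1ℤ)
    8r-2 = solve-∀
    halve : ∀ r y z → + 8 * r * y * (+ 2 * z) ≡ + 2 * (r * (+ 8 * (y * z)))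
    halve = solve-∀
    expand : ∀ z a⁵ b₁ b₂ →
      + 15 * (z + (b₁ * 0ℤ + (b₂ * - (+ 16 * a⁵) + 0ℤ)))
        ≡ + 3 * (+ 5 * z - + 40 * (a⁵ * (+ 2 * b₂)))
    expand = solve-∀
    collect : ∀ c h → + 24 * (c * h) ≡ + 8 * c * (+ 3 * h)
    collect = solve-∀
    difference : ∀ r a³ a⁵ y →
      (+ 8 * r - 1ℤ) * (+ 4 * r - 1ℤ) * (+ 5 * (+ 2 * a³) - + 40 * (a⁵ * y))
        - ((+ 10 - + 15 * (+ 8 * r)) * a³ - + 40 * (a⁵ * y))
        ≡ a³ * (+ 64 * (r * (+ 5 * r))) + a⁵ * (+ 16 * (r * (+ 10 * (+ 3 - + 8 * r) * y)))
    difference = solve-∀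

  term₄ : + 45 * (+ (X C 4) * G 4) ≡ r * (+ 24 * p₄ a a³ a⁵ a⁷ (+ b) (+ 8 * r)) [mod r * (+ 2) ^ 13 ]
  term₄ = scaled-product (+ 3) (+ 15) (+ (X C 4)) (G 4) r (+ 2 * c) (- + 4 * p) p ((+ 2) ^ 12)
    (cancel-factor (+ 8) (+ 3) (+ (X C 4)) (C₄ X) (trans
      (cong₂ _*_ (cong₂ _*_ (cong₂ _*_ X≡8r (X-k 1ℤ)) (trans (X-k (+ 2)) (8r-2 r))) (X-k (+ 3)))
      (divide-by-8 r (+ 8 * r - 1ℤ) (+ 4 * r - 1ℤ) (+ 8 * r - + 3))))
    (mod-trans (+ 15 * G 4) (+ 15 * S) (- + 4 * p)
      -- 3 C(X,4) is r times 2 times an odd number, so `G 4` is needed modulo 2^12 and the term with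
      -- a⁷ survives.
      (mod-* (+ 15) (G 4) S (transform-truncated {c = + 16 * (+ 17 * a⁷)} 2∣a ∣-refl (≡⇒≡mod e₇) 4 b 4 λ _ → refl))
      (≡⇒≡mod (trans (expand a⁵ a⁷ (+ (b C 0)) (+ (b C 1)) (+ (b C 2)) (+ (b C 3)))
        (cong₂ (λ x y → - + 4 * (+ 60 * (a⁵ * x) - + 170 * (a⁷ * y))) (C₁ b) (C₃ b)))))
    (*-∣ {+ 2} {(+ 2) ^ 12} (∣m⇒∣m*n c (∣-refl {+ 2})) (∣-refl {(+ 2) ^ 12}))
    (subst₂ (_≡_[mod (+ 2) ^ 13 ]) (collect c p) (sym (ℤ.*-assoc (+ 8) (+ 3) p))
      (mod-scale {+ 8} {(+ 2) ^ 10} (+ 8) (- c * p) (+ 3 * p) ∣-refl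
        -- As 128 ∣ p, only -c modulo 8 matters, and it is 3 because r is even.
        (subst ((+ 2) ^ 10 ∣_) (sym (difference r p))
          (*-∣ {+ 8} {+ 128} (*-∣ {+ 4} {+ 2} (∣-refl {+ 4}) (∣m⇒∣m*n (+ 48 * r - + 11 - + 64 * r * r) 2∣r)) 128∣p))))
    where
    p = p₄ a a³ a⁵ a⁷ (+ b) (+ 8 * r)
    c = (+ 8 * r - 1ℤ) * (+ 4 * r - 1ℤ) * (+ 8 * r - + 3)
    S = ∑[ i < 4 ] (+ (b C toℕ i) * e-truncated a (+ 16 * (+ 17 * a⁷)) (4 ℕ.+ toℕ i))
    128∣p : + 128 ∣ p
    128∣p = ∣m∣n⇒∣m-n
      (*-∣ {+ 4} {+ 32} (divides (+ 15) refl) (∣m⇒∣m*n (+ b) 32∣a⁵))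
      (∣n⇒∣m*n (+ 170) (∣m⇒∣m*n (+ b * (+ b - 1ℤ) * (+ b - + 2)) 128∣a⁷))
    8r-2 : ∀ r → + 8 * r - + 2 ≡ + 2 * (+ 4 * r - 1ℤ)
    8r-2 = solve-∀
    divide-by-8 : ∀ r y z w → + 8 * r * y * (+ 2 * z) * w ≡ + 8 * (r * (+ 2 * (y * z * w)))
    divide-by-8 = solve-∀
    expand : ∀ a⁵ a⁷ b₀ b₁ b₂ b₃ →
      + 15 * (b₀ * 0ℤ + (b₁ * - (+ 16 * a⁵) + (b₂ * 0ℤ + (b₃ * (+ 16 * (+ 17 * a⁷)) + 0ℤ))))
        ≡ - + 4 * (+ 60 * (a⁵ * b₁) - + 170 * (a⁷ * (+ 6 * b₃)))
    expand = solve-∀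
    collect : ∀ c p → + 8 * (- c * p) ≡ + 2 * c * (- + 4 * p)
    collect = solve-∀
    difference : ∀ r p →
      - ((+ 8 * r - 1ℤ) * (+ 4 * r - 1ℤ) * (+ 8 * r - + 3)) * p - + 3 * p
        ≡ + 4 * (r * (+ 48 * r - + 11 - + 64 * r * r)) * p
    difference = solve-∀

  term₅ : + 45 * (+ (X C 5) * G 5) ≡ r * (+ 24 * p₅ a a³ a⁵ a⁷ (+ b) (+ 8 * r)) [mod r * (+ 2) ^ 13 ]
  term₅ = scaled-product (+ 15) (+ 3) (+ (X C 5)) (G 5) r (+ 8 * c) (+ 3 * p) p ((+ 2) ^ 11)
    (cancel-factor (+ 8) (+ 15) (+ (X C 5)) (C₅ X) (trans
      (cong₂ _*_ (cong₂ _*_ (cong₂ _*_ (cong₂ _*_ X≡8r (X-k 1ℤ)) (trans (X-k (+ 2)) (8r-2 r))) (X-k (+ 3)))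
        (trans (X-k (+ 4)) (8r-4 r)))
      (divide-by-8 r (+ 8 * r - 1ℤ) (+ 4 * r - 1ℤ) (+ 8 * r - + 3) (+ 2 * r - 1ℤ))))
    (mod-trans (+ 3 * G 5) (+ 3 * S) (+ 3 * p)
      (mod-* (+ 3) (G 5) S (transform-truncated {c = 0ℤ} 2∣a 2^11∣2^12 e₇≡0 5 b 1 vanish))
      (≡⇒≡mod (cong (+ 3 *_) (trans (ℤ.+-identityʳ _) (C₀* b p)))))
    (∣-trans (divides (+ 2) refl) (*-∣ {+ 8} {(+ 2) ^ 11} (∣m⇒∣m*n c (∣-refl {+ 8})) (∣-refl {(+ 2) ^ 11})))
    (subst (_≡ + 24 * p [mod (+ 2) ^ 13 ]) (collect c p)
      (mod-scale {+ 8} {(+ 2) ^ 10} (+ 24) (c * p) p (divides (+ 3) refl)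
        -- `c` is odd and 2^9 divides 16a⁵, so the factor `c` may be dropped modulo 2^10.
        (subst ((+ 2) ^ 10 ∣_) (sym (difference r a⁵))
          (*-∣ {+ 32} {+ 32} (∣m⇒∣m*n (+ 25 * r - 1ℤ - + 140 * r * r + + 320 * r * r * r - + 256 * r * r * r * r) (∣-refl {+ 32})) 32∣a⁵))))
    where
    p = p₅ a a³ a⁵ a⁷ (+ b) (+ 8 * r)
    c = (+ 8 * r - 1ℤ) * (+ 4 * r - 1ℤ) * (+ 8 * r - + 3) * (+ 2 * r - 1ℤ)
    S = ∑[ i < 1 ] (+ (b C toℕ i) * e-truncated a 0ℤ (5 ℕ.+ toℕ i))
    8r-2 : ∀ r → + 8 * r - + 2 ≡ + 2 * (+ 4 * r - 1ℤ)
    8r-2 = solve-∀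
    8r-4 : ∀ r → + 8 * r - + 4 ≡ + 4 * (+ 2 * r - 1ℤ)
    8r-4 = solve-∀
    divide-by-8 : ∀ r y z w v → + 8 * r * y * (+ 2 * z) * w * (+ 4 * v) ≡ + 8 * (r * (+ 8 * (y * z * w * v)))
    divide-by-8 = solve-∀
    collect : ∀ c p → + 24 * (c * p) ≡ + 8 * c * (+ 3 * p)
    collect = solve-∀
    difference : ∀ r a⁵ →
      (+ 8 * r - 1ℤ) * (+ 4 * r - 1ℤ) * (+ 8 * r - + 3) * (+ 2 * r - 1ℤ) * - (+ 16 * a⁵) - - (+ 16 * a⁵)
        ≡ + 32 * (+ 25 * r - 1ℤ - + 140 * r * r + + 320 * r * r * r - + 256 * r * r * r * r) * a⁵
    difference = solve-∀

-- The residual polynomial congruence modulo 2^10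

p : (a a³ a⁵ a⁷ b X : ℤ) → ℤ
p a a³ a⁵ a⁷ b X = p₁ a a³ a⁵ a⁷ b X + p₂ a a³ a⁵ a⁷ b X + p₃ a a³ a⁵ a⁷ b X + p₄ a a³ a⁵ a⁷ b X + p₅ a a³ a⁵ a⁷ b X

R-even R-odd : (a a³ a⁵ b X : ℤ) → ℤ
R-even a a³ a⁵ b X = + 9 * a³ * b ^ 2 - (+ 2 * a³ - + 128 * a) * b + + 86 * a³ - + 257 * a + X * a³ * (b - 1ℤ)
R-odd a a³ a⁵ b X = (a³ - + 2 * a⁵) * b ^ 2 + (+ 30 * a³ + + 128 * a) * b - + 2 * a⁵ + + 86 * a³ + + 127 * a + X * a³ * (b - 1ℤ)

-- The coefficient 15 (as s) and the powers of a are independent variables, to keep the normal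
-- forms small.
15R-even-expand : ∀ s a a³ a⁵ a⁷ b X →
  s * (- a + a³ * (b * (b - 1ℤ))) - + 10 * (a⁵ * (b * (b - 1ℤ) * (b - + 2) * (b - + 3)))
    + (s * ((X - 1ℤ) * a³ * b) + + 20 * (a⁵ * (b * (b - 1ℤ) * (b - + 2))))
    + ((+ 10 - s * X) * a³ - + 40 * (a⁵ * (b * (b - 1ℤ))))
    + (+ 60 * (a⁵ * b) - + 170 * (a⁷ * (b * (b - 1ℤ) * (b - + 2))))
    + - (+ 16 * a⁵)
    - s * (+ 9 * a³ * (b * (b * 1ℤ)) - (+ 2 * a³ - + 128 * a) * b + + 86 * a³ - + 257 * a + X * a³ * (b - 1ℤ))
  ≡ a * (s * (+ 256 - + 128 * b)) + a³ * (+ 10 - s * (+ 8 * (b * b) + + 86))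
    + a⁵ * (+ 20 * (b * (b - 1ℤ) * (b - + 2)) - + 10 * (b * (b - 1ℤ) * (b - + 2) * (b - + 3))
        - + 40 * (b * (b - 1ℤ)) + + 60 * b - + 16)
    - a⁷ * (+ 170 * (b * (b - 1ℤ) * (b - + 2)))
15R-even-expand = solve-∀

15R-odd-expand : ∀ s a a³ a⁵ a⁷ b X →
  s * (- a + a³ * (b * (b - 1ℤ))) - + 10 * (a⁵ * (b * (b - 1ℤ) * (b - + 2) * (b - + 3)))
    + (s * ((X - 1ℤ) * a³ * b) + + 20 * (a⁵ * (b * (b - 1ℤ) * (b - + 2))))
    + ((+ 10 - s * X) * a³ - + 40 * (a⁵ * (b * (b - 1ℤ))))
    + (+ 60 * (a⁵ * b) - + 170 * (a⁷ * (b * (b - 1ℤ) * (b - + 2))))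
    + - (+ 16 * a⁵)
    - s * ((a³ - + 2 * a⁵) * (b * (b * 1ℤ)) + (+ 30 * a³ + + 128 * a) * b - + 2 * a⁵ + + 86 * a³ + + 127 * a + X * a³ * (b - 1ℤ))
  ≡ a * (s * (- + 128 - + 128 * b)) + a³ * (+ 10 - s * (+ 32 * b + + 86))
    + a⁵ * ((+ 20 * (b * (b - 1ℤ) * (b - + 2)) - + 10 * (b * (b - 1ℤ) * (b - + 2) * (b - + 3))
        - + 40 * (b * (b - 1ℤ)) + + 60 * b - + 16) + s * (+ 2 * (b * b) + + 2))
    - a⁷ * (+ 170 * (b * (b - 1ℤ) * (b - + 2)))
15R-odd-expand = solve-∀

-- In the odd case only the square is recorded: every odd power of A is A times a power of A², so A²
-- ≡ 1 modulo 4 decides the congruences below.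
even-or-square : ∀ i → (∃[ j ] i ≡ + 2 * j) ⊎ (∃[ j ] i * i ≡ 1ℤ + + 4 * j)
even-or-square i with i %ℕ 2 | n%ℕd<d i 2 | a≡a%ℕn+[a/ℕn]*n i 2
... | 0 | _ | i≡ = inj₁ (i /ℕ 2 , trans i≡ (trans (ℤ.+-identityˡ _) (ℤ.*-comm (i /ℕ 2) (+ 2))))
... | 1 | _ | i≡ = inj₂ (i /ℕ 2 * (1ℤ + i /ℕ 2) , trans (cong (λ x → x * x) i≡) (square (i /ℕ 2)))
  where
  square : ∀ j → (1ℤ + j * + 2) * (1ℤ + j * + 2) ≡ 1ℤ + + 4 * (j * (1ℤ + j))
  square = solve-∀
... | suc (suc _) | ℕ.s≤s (ℕ.s≤s ()) | _

module Parity (A : ℤ) where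

  A³ A⁵ A⁷ : ℤ
  A³ = A ^ 3
  A⁵ = A ^ 5
  A⁷ = A ^ 7

  private
    A³≡ : ∀ {w} → A * A ≡ w → A³ ≡ A * w
    A³≡ refl = identity A
      where
      identity : ∀ A → A * (A * (A * 1ℤ)) ≡ A * (A * A)
      identity = solve-∀
    A⁵≡ : ∀ {w} → A * A ≡ w → A⁵ ≡ A * w * w
    A⁵≡ refl = identity A
      where
      identity : ∀ A → A * (A * (A * (A * (A * 1ℤ)))) ≡ A * (A * A) * (A * A)
      identity = solve-∀
    A⁷≡ : ∀ {w} → A * A ≡ w → A⁷ ≡ A * w * w * w
    A⁷≡ refl = identity A
      where
      identity : ∀ A → A * (A * (A * (A * (A * (A * (A * 1ℤ)))))) ≡ A * (A * A) * (A * A) * (A * A)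
      identity = solve-∀

    4∣even² : ∀ {j} → A ≡ + 2 * j → + 4 ∣ A * A
    4∣even² {j} refl = *-∣ {+ 2} {+ 2} (∣m⇒∣m*n j (∣-refl {+ 2})) (∣m⇒∣m*n j (∣-refl {+ 2}))

    4∣A³ : + 4 ∣ A * A → + 4 ∣ A³
    4∣A³ 4∣A² = subst (+ 4 ∣_) (sym (A³≡ refl)) (∣n⇒∣m*n A 4∣A²)

    4∣A⁵ : + 4 ∣ A * A → + 4 ∣ A⁵
    4∣A⁵ 4∣A² = subst (+ 4 ∣_) (sym (A⁵≡ refl)) (∣n⇒∣m*n (A * (A * A)) 4∣A²)

    4∣A⁷ : + 4 ∣ A * A → + 4 ∣ A⁷
    4∣A⁷ 4∣A² = subst (+ 4 ∣_) (sym (A⁷≡ refl)) (∣n⇒∣m*n (A * (A * A) * (A * A)) 4∣A²)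

    2∣4 : + 2 ∣ + 4
    2∣4 = divides (+ 2) refl

    2∣even : ∀ {j} → A ≡ + 2 * j → + 2 ∣ A
    2∣even {j} refl = ∣m⇒∣m*n j (∣-refl {+ 2})

  4∣A³-A⁵ : + 4 ∣ A³ - A⁵
  4∣A³-A⁵ with even-or-square A
  ... | inj₁ (j , A≡2j) = ∣m∣n⇒∣m-n (4∣A³ (4∣even² A≡2j)) (4∣A⁵ (4∣even² A≡2j))
  ... | inj₂ (j , A²≡)  = subst (+ 4 ∣_) (sym (trans (cong₂ _-_ (A³≡ A²≡) (A⁵≡ A²≡)) (identity A j)))
    (∣m⇒∣m*n (- (A * (1ℤ + + 4 * j) * j)) (∣-refl {+ 4}))
    where
    identity : ∀ A j → A * (1ℤ + + 4 * j) - A * (1ℤ + + 4 * j) * (1ℤ + + 4 * j) ≡ + 4 * - (A * (1ℤ + + 4 * j) * j)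
    identity = solve-∀

  2∣A+A⁵ : + 2 ∣ A + A⁵
  2∣A+A⁵ with even-or-square A
  ... | inj₁ (j , A≡2j) = ∣m∣n⇒∣m+n (2∣even A≡2j) (∣-trans 2∣4 (4∣A⁵ (4∣even² A≡2j)))
  ... | inj₂ (j , A²≡)  = subst (+ 2 ∣_) (sym (trans (cong (_+_ A) (A⁵≡ A²≡)) (identity A j)))
    (∣m⇒∣m*n (A * (1ℤ + + 4 * j + + 8 * (j * j))) (∣-refl {+ 2}))
    where
    identity : ∀ A j → A + A * (1ℤ + + 4 * j) * (1ℤ + + 4 * j) ≡ + 2 * (A * (1ℤ + + 4 * j + + 8 * (j * j)))
    identity = solve-∀

  4∣2A+A³+A⁵ : + 4 ∣ + 2 * A + A³ + A⁵
  4∣2A+A³+A⁵ with even-or-square A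
  ... | inj₁ (j , A≡2j) = ∣m∣n⇒∣m+n (∣m∣n⇒∣m+n (*-monoʳ-∣ (+ 2) (2∣even A≡2j)) (4∣A³ (4∣even² A≡2j))) (4∣A⁵ (4∣even² A≡2j))
  ... | inj₂ (j , A²≡)  = subst (+ 4 ∣_) (sym (trans (cong₂ (λ x y → + 2 * A + x + y) (A³≡ A²≡) (A⁵≡ A²≡)) (identity A j)))
    (∣m⇒∣m*n (A * (1ℤ + + 3 * j + + 4 * (j * j))) (∣-refl {+ 4}))
    where
    identity : ∀ A j → + 2 * A + A * (1ℤ + + 4 * j) + A * (1ℤ + + 4 * j) * (1ℤ + + 4 * j) ≡ + 4 * (A * (1ℤ + + 3 * j + + 4 * (j * j)))
    identity = solve-∀

  2∣A³+A⁷ : + 2 ∣ A³ + A⁷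
  2∣A³+A⁷ with even-or-square A
  ... | inj₁ (j , A≡2j) = ∣-trans 2∣4 (∣m∣n⇒∣m+n (4∣A³ (4∣even² A≡2j)) (4∣A⁷ (4∣even² A≡2j)))
  ... | inj₂ (j , A²≡)  = subst (+ 2 ∣_) (sym (trans (cong₂ _+_ (A³≡ A²≡) (A⁷≡ A²≡)) (identity A (1ℤ + + 4 * j))))
    (∣n⇒∣m*n (A * (1ℤ + + 4 * j)) (subst (+ 2 ∣_) (sym (square j))
      (∣m⇒∣m*n (1ℤ + + 4 * j + + 8 * (j * j)) (∣-refl {+ 2}))))
    where
    identity : ∀ A w → A * w + A * w * w * w ≡ A * w * (1ℤ + w * w)
    identity = solve-∀
    square : ∀ j → 1ℤ + (1ℤ + + 4 * j) * (1ℤ + + 4 * j) ≡ + 2 * (1ℤ + + 4 * j + + 8 * (j * j))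
    square = solve-∀

[2*i]^n≡2^n*i^n : ∀ A n → (+ 2 * A) ^ n ≡ (+ 2) ^ n * A ^ n
[2*i]^n≡2^n*i^n A zero    = refl
[2*i]^n≡2^n*i^n A (suc n) = trans (cong (+ 2 * A *_) ([2*i]^n≡2^n*i^n A n)) (shuffle A ((+ 2) ^ n) (A ^ n))
  where
  shuffle : ∀ A x y → + 2 * A * (x * y) ≡ + 2 * x * (A * y)
  shuffle = solve-∀

module Reduction (A β X : ℤ) where

  open Parity A

  private
    a = + 2 * A

  -- With a = 2A the powers a, a³, a⁵, a⁷ bring 2, 8, 32, 128, which the factors 128, 32, 8, 2
  -- complete to 256. A congruence modulo 4 between polynomials in A and β remains, X having
  -- cancelled in p - 15R.
  rescale : ∀ {q₁ q₃ q₅ q₇ k₁ k₃ k₅ k₇} →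
    q₁ ≡ + 128 * k₁ → q₃ ≡ + 32 * k₃ → q₅ ≡ + 8 * k₅ → q₇ ≡ + 2 * k₇ →
    a * q₁ + a ^ 3 * q₃ + a ^ 5 * q₅ - a ^ 7 * q₇ ≡ + 256 * (A * k₁ + A³ * k₃ + A⁵ * k₅ - A⁷ * k₇)
  rescale {k₁ = k₁} {k₃} {k₅} {k₇} refl refl refl refl = begin
    a * (+ 128 * k₁) + a ^ 3 * (+ 32 * k₃) + a ^ 5 * (+ 8 * k₅) - a ^ 7 * (+ 2 * k₇)
      ≡⟨ cong₂ (λ x y → a * (+ 128 * k₁) + x + a ^ 5 * (+ 8 * k₅) - y)
          (cong (_* (+ 32 * k₃)) ([2*i]^n≡2^n*i^n A 3)) (cong (_* (+ 2 * k₇)) ([2*i]^n≡2^n*i^n A 7)) ⟩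
    a * (+ 128 * k₁) + + 8 * A³ * (+ 32 * k₃) + a ^ 5 * (+ 8 * k₅) - + 128 * A⁷ * (+ 2 * k₇)
      ≡⟨ cong (λ x → a * (+ 128 * k₁) + + 8 * A³ * (+ 32 * k₃) + x * (+ 8 * k₅) - + 128 * A⁷ * (+ 2 * k₇)) ([2*i]^n≡2^n*i^n A 5) ⟩
    a * (+ 128 * k₁) + + 8 * A³ * (+ 32 * k₃) + + 32 * A⁵ * (+ 8 * k₅) - + 128 * A⁷ * (+ 2 * k₇)
      ≡⟨ collect A A³ A⁵ A⁷ k₁ k₃ k₅ k₇ ⟩
    + 256 * (A * k₁ + A³ * k₃ + A⁵ * k₅ - A⁷ * k₇) ∎
    where
    collect : ∀ A A³ A⁵ A⁷ k₁ k₃ k₅ k₇ →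
      + 2 * A * (+ 128 * k₁) + + 8 * A³ * (+ 32 * k₃) + + 32 * A⁵ * (+ 8 * k₅) - + 128 * A⁷ * (+ 2 * k₇)
        ≡ + 256 * (A * k₁ + A³ * k₃ + A⁵ * k₅ - A⁷ * k₇)
    collect = solve-∀

  even-case : p a (a ^ 3) (a ^ 5) (a ^ 7) (+ 2 * β) X ≡ + 15 * R-even a (a ^ 3) (a ^ 5) (+ 2 * β) X [mod (+ 2) ^ 10 ]
  even-case = subst ((+ 2) ^ 10 ∣_)
    (sym (trans (15R-even-expand (+ 15) a (a ^ 3) (a ^ 5) (a ^ 7) (+ 2 * β) X)
      (rescale (q₁ (+ 15) β) (q₃ β) (q₅ β) (q₇ β))))
    (*-∣ {+ 256} {+ 4} (∣-refl {+ 256}) (subst (+ 4 ∣_) (sym (mod-4 A A³ A⁵ A⁷ β))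
      (∣m∣n⇒∣m+n (∣m∣n⇒∣m+n
        (∣m⇒∣m*n (1ℤ + β) (*-monoʳ-∣ (+ 2) 2∣A+A⁵))
        (∣n⇒∣m*n (β * β) 4∣A³-A⁵))
        (∣m⇒∣m*n (A * (+ 7 - + 8 * β) - A³ * (+ 10 + + 4 * (β * β))
          + A⁵ * (+ 12 * β - 1ℤ - + 26 * (β * β) + + 20 * (β * β * β) - + 5 * (β * β * β * β))
          - A⁷ * (+ 85 * (β * (+ 2 * β - 1ℤ) * (β - 1ℤ)))) (∣-refl {+ 4})))))
    where
    q₁ : ∀ s β → s * (+ 256 - + 128 * (+ 2 * β)) ≡ + 128 * (s * (+ 2 - + 2 * β))
    q₁ = solve-∀
    q₃ : ∀ β → let b = + 2 * β in
      + 10 - + 15 * (+ 8 * (b * b) + + 86) ≡ + 32 * - (+ 40 + + 15 * (β * β))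
    q₃ = solve-∀
    q₅ : ∀ β → let b = + 2 * β in
      + 20 * (b * (b - 1ℤ) * (b - + 2)) - + 10 * (b * (b - 1ℤ) * (b - + 2) * (b - + 3))
        - + 40 * (b * (b - 1ℤ)) + + 60 * b - + 16
      ≡ + 8 * (- + 2 + + 50 * β - + 105 * (β * β) + + 80 * (β * β * β) - + 20 * (β * β * β * β))
    q₅ = solve-∀
    q₇ : ∀ β → let b = + 2 * β in
      + 170 * (b * (b - 1ℤ) * (b - + 2)) ≡ + 2 * (+ 340 * (β * (+ 2 * β - 1ℤ) * (β - 1ℤ)))
    q₇ = solve-∀
    -- Modulo 4 the coefficients of A, A³, A⁵, A⁷ are 2 + 2β, β², 2 + 2β - β² and 0; the multiples
    -- of 4 are collected in the last summand.
    mod-4 : ∀ A A³ A⁵ A⁷ β →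
      A * (+ 15 * (+ 2 - + 2 * β)) + A³ * - (+ 40 + + 15 * (β * β))
        + A⁵ * (- + 2 + + 50 * β - + 105 * (β * β) + + 80 * (β * β * β) - + 20 * (β * β * β * β))
        - A⁷ * (+ 340 * (β * (+ 2 * β - 1ℤ) * (β - 1ℤ)))
      ≡ + 2 * (A + A⁵) * (1ℤ + β) + β * β * (A³ - A⁵)
        + + 4 * (A * (+ 7 - + 8 * β) - A³ * (+ 10 + + 4 * (β * β))
          + A⁵ * (+ 12 * β - 1ℤ - + 26 * (β * β) + + 20 * (β * β * β) - + 5 * (β * β * β * β))
          - A⁷ * (+ 85 * (β * (+ 2 * β - 1ℤ) * (β - 1ℤ))))
    mod-4 = solve-∀

  odd-case : p a (a ^ 3) (a ^ 5) (a ^ 7) (1ℤ + + 2 * β) X ≡ + 15 * R-odd a (a ^ 3) (a ^ 5) (1ℤ + + 2 * β) X [mod (+ 2) ^ 10 ]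
  odd-case = subst ((+ 2) ^ 10 ∣_)
    (sym (trans (15R-odd-expand (+ 15) a (a ^ 3) (a ^ 5) (a ^ 7) (1ℤ + + 2 * β) X)
      (rescale (q₁ (+ 15) β) (q₃ β) (q₅ β) (q₇ β))))
    (*-∣ {+ 256} {+ 4} (∣-refl {+ 256}) (subst (+ 4 ∣_) (sym (mod-4 A A³ A⁵ A⁷ β))
      (∣m∣n⇒∣m+n (∣m∣n⇒∣m+n
        4∣2A+A³+A⁵
        (∣m⇒∣m*n β (*-monoʳ-∣ (+ 2) (∣m∣n⇒∣m+n 2∣A+A⁵ 2∣A³+A⁷))))
        (∣m⇒∣m*n (- (A * (+ 8 + + 8 * β)) - A³ * (+ 14 + + 8 * β)
          + A⁵ * (+ 3 + + 2 * β + + 10 * (β * β * β) - + 5 * (β * β * β * β))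
          - A⁷ * (+ 170 * (β * β * β) - + 42 * β)) (∣-refl {+ 4})))))
    where
    q₁ : ∀ s β → s * (- + 128 - + 128 * (1ℤ + + 2 * β)) ≡ + 128 * (s * - (+ 2 + + 2 * β))
    q₁ = solve-∀
    q₃ : ∀ β → + 10 - + 15 * (+ 32 * (1ℤ + + 2 * β) + + 86) ≡ + 32 * - (+ 55 + + 30 * β)
    q₃ = solve-∀
    q₅ : ∀ β → let b = 1ℤ + + 2 * β in
      + 20 * (b * (b - 1ℤ) * (b - + 2)) - + 10 * (b * (b - 1ℤ) * (b - + 2) * (b - + 3))
        - + 40 * (b * (b - 1ℤ)) + + 60 * b - + 16 + + 15 * (+ 2 * (b * b) + + 2)
      ≡ + 8 * (+ 13 + + 10 * β + + 40 * (β * β * β) - + 20 * (β * β * β * β))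
    q₅ = solve-∀
    q₇ : ∀ β → let b = 1ℤ + + 2 * β in
      + 170 * (b * (b - 1ℤ) * (b - + 2)) ≡ + 2 * (+ 680 * (β * β * β) - + 170 * β)
    q₇ = solve-∀
    -- Modulo 4 the coefficients are 2 + 2β, 1 + 2β, 1 + 2β and 2β; the sign of the last is
    -- immaterial since 2β ≡ -2β.
    mod-4 : ∀ A A³ A⁵ A⁷ β →
      A * (+ 15 * - (+ 2 + + 2 * β)) + A³ * - (+ 55 + + 30 * β)
        + A⁵ * (+ 13 + + 10 * β + + 40 * (β * β * β) - + 20 * (β * β * β * β))
        - A⁷ * (+ 680 * (β * β * β) - + 170 * β)
      ≡ + 2 * A + A³ + A⁵ + + 2 * (A + A⁵ + (A³ + A⁷)) * β
        + + 4 * (- (A * (+ 8 + + 8 * β)) - A³ * (+ 14 + + 8 * β)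
          + A⁵ * (+ 3 + + 2 * β + + 10 * (β * β * β) - + 5 * (β * β * β * β))
          - A⁷ * (+ 170 * (β * β * β) - + 42 * β))
    mod-4 = solve-∀

-- Summation of the five terms and cancellation of 45

2^∣45*i⇒2^∣i : ∀ n i → (+ 2) ^ n ∣ + 45 * i → (+ 2) ^ n ∣ i
-- The argument 22 encodes the odd number 45 = 1 + 2 · 22.
2^∣45*i⇒2^∣i n i 2^n∣ = subst (_∣ i) (pos-^ 2 n) (∣ᵤ⇒∣ {+ (2 ℕ.^ n)} {i} (2^∣odd*c⇒2^∣c 22 n ∣ i ∣
  (subst (2 ℕ.^ n ℕ.∣_) (ℤ.abs-* (+ 45) i) (∣⇒∣ᵤ (subst (_∣ + 45 * i) (sym (pos-^ 2 n)) 2^n∣)))))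

-- The exponent of the theorem is `4 + m` here. The chain is 45Δ ≡ 45T ≡ 24rP ≡ 24r · 15R = 45XR,
-- the last equality because X = 8r; then 45 is cancelled.
E-increment : ∀ {a} → + 2 ∣ a → ∀ k m b (R : ℤ) → let X = (+ 2) ^ (4 ℕ.+ m) * + k in
  p a (a ^ 3) (a ^ 5) (a ^ 7) (+ b) X ≡ + 15 * R [mod (+ 2) ^ 10 ] →
  E a (2 ℕ.^ (4 ℕ.+ m) ℕ.* k ℕ.+ b) - E a b ≡ X * R [mod (+ 2) ^ (4 ℕ.+ m ℕ.+ 10) ]
E-increment {a} 2∣a k m b R p≡15R = 2^∣45*i⇒2^∣i (4 ℕ.+ m ℕ.+ 10) _
  (subst (M ∣_) (sym (distribute (+ 45) Δ (X * R))) (mod-trans (+ 45 * Δ) (+ 45 * T) (+ 45 * (X * R))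
    (mod-* (+ 45) Δ T Δ≡T)
    (mod-trans (+ 45 * T) (r * (+ 24 * P)) (+ 45 * (X * R)) (∣-trans M∣ 45T≡24rP)
      (subst (r * (+ 24 * P) ≡_[mod M ]) (sym 45XR≡) (∣-trans M∣ 24rP≡)))))
  where
  n = 2 ℕ.^ (4 ℕ.+ m) ℕ.* k
  X = (+ 2) ^ (4 ℕ.+ m) * + k
  M = (+ 2) ^ (4 ℕ.+ m ℕ.+ 10)
  r = + 2 * ((+ 2) ^ m * + k)
  Δ = E a (n ℕ.+ b) - E a b
  P = p a (a ^ 3) (a ^ 5) (a ^ 7) (+ b) (+ 8 * r)

  distribute : ∀ c x y → c * (x - y) ≡ c * x - c * y
  distribute = solve-∀

  X≡8r : X ≡ + 8 * r
  X≡8r = identity ((+ 2) ^ m) (+ k)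
    where
    identity : ∀ x k → + 2 * (+ 2 * (+ 2 * (+ 2 * x))) * k ≡ + 8 * (+ 2 * (x * k))
    identity = solve-∀

  n≡8r : + n ≡ + 8 * r
  n≡8r = trans (ℤ.pos-* (2 ℕ.^ (4 ℕ.+ m)) k) (trans (cong (_* + k) (pos-^ 2 (4 ℕ.+ m))) X≡8r)

  open Terms a r 2∣a (∣m⇒∣m*n ((+ 2) ^ m * + k) (∣-refl {+ 2})) n n≡8r b

  T = + (n C 1) * G 1 + (+ (n C 2) * G 2 + (+ (n C 3) * G 3 + (+ (n C 4) * G 4 + (+ (n C 5) * G 5 + 0ℤ))))

  -- r · 2^13 = X · 2^10 = k · M.
  M∣ : M ∣ r * (+ 2) ^ 13
  M∣ = subst₂ _∣_ (sym (ℤ.^-distribˡ-+-* (+ 2) (4 ℕ.+ m) 10)) (identity ((+ 2) ^ m) (+ k) ((+ 2) ^ 10))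
    (∣n⇒∣m*n (+ k) (∣-refl {(+ 2) ^ (4 ℕ.+ m) * (+ 2) ^ 10}))
    where
    identity : ∀ x k y → k * (+ 2 * (+ 2 * (+ 2 * (+ 2 * x))) * y) ≡ + 2 * (x * k) * (+ 8 * y)
    identity = solve-∀

  tail : ∀ N j → 2 ℕ.^ (4 ℕ.+ m) ℕ.∣ N → M ∣ + (N C (6 ℕ.+ j)) * G (6 ℕ.+ j)
  tail zero    j _     = divides 0ℤ (cong (λ c → + c * G (6 ℕ.+ j)) (k>n⇒nCk≡0 {0} {6 ℕ.+ j} (ℕ.s≤s ℕ.z≤n)))
  tail (suc N) j 2^m∣N = 2^∣C*transform 2∣a (4 ℕ.+ m) N b (5 ℕ.+ j) (ℕ.m≤m+n 6 j) 2^m∣N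

  E≡transform : ∀ i → E a i ≡ transform (e a) i
  E≡transform = E≗1-tanh a

  Δ≡T : Δ ≡ T [mod M ]
  Δ≡T = subst (M ∣_) (begin
      transform G n - (+ (n C 0) * G 0 + T)   ≡⟨ cong₂ (λ x y → x - (y + T))
        (trans (sym (transform-+ (e a) n b)) (sym (E≡transform (n ℕ.+ b))))
        (trans (C₀* n (G 0)) (sym (E≡transform b))) ⟩
      E a (n ℕ.+ b) - (E a b + T)             ≡⟨ regroup (E a (n ℕ.+ b)) (E a b) T ⟩
      Δ - T ∎)
    (transform-mod G n 6 λ j → tail n j (ℕ.m∣m*n k))
    where
    regroup : ∀ x y z → x - (y + z) ≡ x - y - z
    regroup = solve-∀

  45T≡24rP : + 45 * T ≡ r * (+ 24 * P) [mod r * (+ 2) ^ 13 ]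
  45T≡24rP = subst₂ (_≡_[mod r * (+ 2) ^ 13 ])
    (expand (+ (n C 1) * G 1) (+ (n C 2) * G 2) (+ (n C 3) * G 3) (+ (n C 4) * G 4) (+ (n C 5) * G 5))
    (collect r (P′ p₁) (P′ p₂) (P′ p₃) (P′ p₄) (P′ p₅))
    (mod-+ {x = + 45 * (+ (n C 1) * G 1)} {r * (+ 24 * P′ p₁)} term₁
    (mod-+ {x = + 45 * (+ (n C 2) * G 2)} {r * (+ 24 * P′ p₂)} term₂
    (mod-+ {x = + 45 * (+ (n C 3) * G 3)} {r * (+ 24 * P′ p₃)} term₃
    (mod-+ {x = + 45 * (+ (n C 4) * G 4)} {r * (+ 24 * P′ p₄)} {+ 45 * (+ (n C 5) * G 5)} {r * (+ 24 * P′ p₅)} term₄ term₅))))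
    where
    P′ : ((a a³ a⁵ a⁷ b X : ℤ) → ℤ) → ℤ
    P′ p = p a (a ^ 3) (a ^ 5) (a ^ 7) (+ b) (+ 8 * r)
    expand : ∀ v w x y z → + 45 * v + (+ 45 * w + (+ 45 * x + (+ 45 * y + + 45 * z)))
      ≡ + 45 * (v + (w + (x + (y + (z + 0ℤ)))))
    expand = solve-∀
    collect : ∀ r v w x y z → r * (+ 24 * v) + (r * (+ 24 * w) + (r * (+ 24 * x) + (r * (+ 24 * y) + r * (+ 24 * z))))
      ≡ r * (+ 24 * (v + w + x + y + z))
    collect = solve-∀

  24rP≡ : r * (+ 24 * P) ≡ r * (+ 24 * (+ 15 * R)) [mod r * (+ 2) ^ 13 ]
  24rP≡ = mod-scale {r} {(+ 2) ^ 13} r (+ 24 * P) (+ 24 * (+ 15 * R)) ∣-refl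
    (mod-scale {+ 8} {(+ 2) ^ 10} (+ 24) P (+ 15 * R) (divides (+ 3) refl)
      (subst (λ x → p a (a ^ 3) (a ^ 5) (a ^ 7) (+ b) x ≡ + 15 * R [mod (+ 2) ^ 10 ]) X≡8r p≡15R))

  45XR≡ : + 45 * (X * R) ≡ r * (+ 24 * (+ 15 * R))
  45XR≡ = trans (cong (λ x → + 45 * (x * R)) X≡8r) (identity r R)
    where
    identity : ∀ r R → + 45 * (+ 8 * r * R) ≡ r * (+ 24 * (+ 15 * R))
    identity = solve-∀

theorem2p1 : (a : ℤ) → a ≢ 0ℤ → + 2 ∣ a →
    (k m : ℕ) → 1 ℕ.≤ k → 4 ℕ.≤ m → (b : ℕ) →
    (2 ℕ.∣ b →
    E a (2 ℕ.^ m ℕ.* k ℕ.+ b) - E a b ≡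
    (+ 2) ^ m * + k *
    (+ 9 * a ^ 3 * (+ b) ^ 2 - (+ 2 * a ^ 3 - + 128 * a) * + b
    + + 86 * a ^ 3 - + 257 * a
    + (+ 2) ^ m * + k * a ^ 3 * (+ b - 1ℤ))
    [mod (+ 2) ^ (m ℕ.+ 10) ])
    ×
    (¬ (2 ℕ.∣ b) →
    E a (2 ℕ.^ m ℕ.* k ℕ.+ b) - E a b ≡
    (+ 2) ^ m * + k *
    ((a ^ 3 - + 2 * a ^ 5) * (+ b) ^ 2 + (+ 30 * a ^ 3 + + 128 * a) * + b
    - + 2 * a ^ 5 + + 86 * a ^ 3 + + 127 * a
    + (+ 2) ^ m * + k * a ^ 3 * (+ b - 1ℤ))
    [mod (+ 2) ^ (m ℕ.+ 10) ])
theorem2p1 _ _ (divides A refl) k (suc (suc (suc (suc m)))) _ (ℕ.s≤s (ℕ.s≤s (ℕ.s≤s (ℕ.s≤s _)))) b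
  rewrite ℤ.*-comm A (+ 2) = even , odd
  where
  a = + 2 * A
  X = (+ 2) ^ (4 ℕ.+ m) * + k
  2∣a : + 2 ∣ a
  2∣a = ∣m⇒∣m*n A (∣-refl {+ 2})
  even : 2 ℕ.∣ b → E a (2 ℕ.^ (4 ℕ.+ m) ℕ.* k ℕ.+ b) - E a b ≡ X * R-even a (a ^ 3) (a ^ 5) (+ b) X
    [mod (+ 2) ^ (4 ℕ.+ m ℕ.+ 10) ]
  even (ℕ.divides β b≡β*2) = E-increment 2∣a k m b (R-even a (a ^ 3) (a ^ 5) (+ b) X)
    (subst (λ b → p a (a ^ 3) (a ^ 5) (a ^ 7) b X ≡ + 15 * R-even a (a ^ 3) (a ^ 5) b X [mod (+ 2) ^ 10 ])
      (sym (trans (cong +_ (trans b≡β*2 (ℕ.*-comm β 2))) (ℤ.pos-* 2 β))) (Reduction.even-case A (+ β) X))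
  odd : ¬ (2 ℕ.∣ b) → E a (2 ℕ.^ (4 ℕ.+ m) ℕ.* k ℕ.+ b) - E a b ≡ X * R-odd a (a ^ 3) (a ^ 5) (+ b) X
    [mod (+ 2) ^ (4 ℕ.+ m ℕ.+ 10) ]
  odd 2∤b with even-or-odd b
  ... | inj₁ (β , b≡2β)   = contradiction (subst (2 ℕ.∣_) (sym b≡2β) (ℕ.m∣m*n β)) 2∤b
  ... | inj₂ (β , b≡1+2β) = E-increment 2∣a k m b (R-odd a (a ^ 3) (a ^ 5) (+ b) X)
    (subst (λ b → p a (a ^ 3) (a ^ 5) (a ^ 7) b X ≡ + 15 * R-odd a (a ^ 3) (a ^ 5) b X [mod (+ 2) ^ 10 ])
      (sym (trans (cong +_ b≡1+2β) (cong (_+_ 1ℤ) (ℤ.pos-* 2 β)))) (Reduction.odd-case A (+ β) X))
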